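{- Let $p$ be an odd prime. Then $$\sum_{k=1}^{(p-1)/2}\frac{\binom{2k}{k}}{2^k}H_k^2\equiv(-1)^{(p-1)/2}q_p(2)^2-E_{p-3}\pmod p.$$
   Context: $H_k=\sum_{0<j\le k}\frac1j$ is the $k$-th harmonic number. $q_p(2)=(2^{p-1}-1)/p$ is the Fermat quotient. The Euler numbers $E_n$ are defined by $\frac{2e^t}{e^{2t}+1}=\sum_{n\ge 0}E_n\frac{t^n}{n!}$. Congruences between rational numbers with denominators coprime to $p$ are understood in the ring of rationals with denominator prime to $p$. -}

module Defs where

open import Data.Nat as ℕ using (ℕ; zero; suc; _∸_; _%_; _≡ᵇ_)
open import Data.Nat.Divisibility using (_∣_)
open import Data.Nat.Combinatorics using (_C_)
open import Data.Bool using (if_then_else_)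
open import Data.Integer as ℤ using (ℤ; +_)
open import Data.List using (List; []; _∷_; _++_; foldr; map; zipWith; upTo)
open import Data.Rational as ℚ using (ℚ; 0ℚ; 1ℚ; ½; _+_; _*_; _-_; -_; _/_; ↥_; ↧ₙ_)
open import Data.Product using (_×_)
open import Relation.Nullary using (¬_)

sumℚ : List ℚ → ℚ
sumℚ = foldr _+_ 0ℚ

∑[_≤_≤_] : ℕ → ℕ → (ℕ → ℚ) → ℚ
∑[ a ≤ b ≤ f ] = sumℚ (map (λ i → f (a ℕ.+ i)) (upTo (suc b ∸ a)))

_^ℚ_ : ℚ → ℕ → ℚ
x ^ℚ zero = 1ℚ
x ^ℚ suc n = x * (x ^ℚ n)

H : ℕ → ℚ
H k = sumℚ (map (λ i → (+ 1) / suc i) (upTo k))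

-- Fermat quotient q_p(2) = (2^{p-1} - 1)/p   (value at p = 0 is irrelevant)
q2 : ℕ → ℚ
q2 zero = 0ℚ
q2 (suc m) = (+ (2 ℕ.^ m ∸ 1)) / suc m

-- Euler numbers: coefficients of 2e^t/(e^{2t}+1) = 1/cosh t.
-- Comparing coefficients of t^n/n! in (∑ E_k t^k/k!)·cosh t = 1 gives
--   ∑_{0≤k≤n, n-k even} C(n,k) E_k = [n = 0],
-- which determines E_n recursively. eulerList n = [E_0, …, E_n].
sumℤ : List ℤ → ℤ
sumℤ = foldr ℤ._+_ (+ 0)

eulerList : ℕ → List ℤ
eulerList zero = + 1 ∷ []
eulerList (suc n) =
  eulerList n ++
  (ℤ.- sumℤ (zipWith (λ k e → if ((suc n ∸ k) % 2 ≡ᵇ 0) then (+ (suc n C k)) ℤ.* e else + 0)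
                      (upTo (suc n)) (eulerList n)) ∷ [])

last : List ℤ → ℤ
last [] = + 0
last (x ∷ []) = x
last (x ∷ y ∷ l) = last (y ∷ l)

E : ℕ → ℤ
E n = last (eulerList n)

-- congruence of rationals modulo p in the ring of rationals with denominator prime to p:
-- both denominators (in lowest terms) are prime to p and p divides the numerator of x - y
_≡_[modℚ_] : ℚ → ℚ → ℕ → Set
x ≡ y [modℚ p ] = (¬ (p ∣ ↧ₙ x)) × (¬ (p ∣ ↧ₙ y)) × (p ∣ ℤ.∣ ↥ (x - y) ∣)

sgn : ℕ → ℚ
sgn n = (- 1ℚ) ^ℚ n

{-# OPTIONS --safe #-}

-- Write p = 2n + 1 and q = q_p(2).  Modulo p, C(2k,k)/4ᵏ ≡ (-1)ᵏ C(n,k), so the sum is the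
-- binomial transform Σ C(n,k) (-2)ᵏ H_k², and the recursion in n of this transform gives
--   (-1)ⁿ Σ C(n,k) (-2)ᵏ H_k² = Σ_{m≤n} (2 + (-1)ᵐ)/m · Σ_{j≤m} (1 - (-1)ʲ)/j.
-- Expanding the right-hand side, everything is expressed by H_n ≡ -2q, Σ_{j≤n} (-1)ʲ/j ≡ -q,
-- Σ_{j≤n} 1/j² ≡ 0, D = Σ_{j≤n} (-1)ʲ/j² and X = Σ_{j≤n} (-1)ʲ H_j/j.  The reflection j ↦ p - j
-- gives 2X ≡ D + W for the full sum W = Σ_{j<p} (-1)ʲ H_j/j, and W ≡ q² follows by grouping
-- Σ_{i+j<p} (-1)ⁱ⁺ʲ/(ij) along i + j with 1/(ij) = (1/i + 1/j)/(i + j).  Finally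
-- E_r ≡ Σ_{j≤p} (-1)ʲ⁻¹ (2j - 1)ʳ, because the right-hand side satisfies the recursion defining
-- E_r modulo p; at r = p - 3 Fermat's theorem turns it into D ≡ 2 (-1)ⁿ E_{p-3}.

module Submission where

open import Defs
open import Data.Bool using (if_then_else_)
open import Data.Empty using (⊥-elim-irr)
open import Data.List using ([]; _∷_; _∷ʳ_; _++_; map; zipWith; upTo)
open import Data.List.Properties using (upTo-∷ʳ; map-++)
open import Data.Nat using (ℕ; zero; suc; s≤s; z≤n; _∸_; _%_; _≡ᵇ_)
open import Data.Nat as ℕ using ()
import Data.Nat.Properties as ℕ
import Data.Nat.Divisibility as ℕ
import Data.Nat.DivMod as ℕ
import Data.Nat.Induction as ℕ
import Data.Nat.Tactic.RingSolver as ℕ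
open import Data.Nat.Primality using (Prime; euclidsLemma)
open import Data.Nat.Combinatorics using (_C_; nCk+nC[k+1]≡[n+1]C[k+1])
open import Data.Integer using (+_)
open import Data.Integer as ℤ using (ℤ; 0ℤ; 1ℤ; -1ℤ)
open import Data.Integer.Divisibility.Signed using (divides; ∣m∣n⇒∣m+n; ∣n⇒∣m*n; ∣-refl; ∣⇒∣ᵤ; ∣ᵤ⇒∣)
open import Data.Integer.Properties
open import Data.Integer.Tactic.RingSolver using (solve-∀)
open import Data.Product using (∃; _×_; _,_)
import Data.Rational as ℚ
import Data.Rational.Properties as ℚ
open import Data.Rational.Unnormalised using (mkℚᵘ; _≃_; *≡*)
import Data.Rational.Unnormalised.Properties as ℚᵘ
open import Data.Sum as Sum using (_⊎_; inj₁; inj₂)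
open import Function using (_∘_)
open import Level using (0ℓ)
open import Relation.Binary.Bundles using (Setoid)
import Relation.Binary.Reasoning.Setoid
open import Relation.Binary.PropositionalEquality using (_≡_; refl; sym; trans; cong; cong₂; subst; module ≡-Reasoning)
open import Relation.Nullary using (¬_; contradiction)
open import Relation.Nullary.Decidable using (from-no)

-- The alternating power sum comes from expanding 2eᵗ/(e²ᵗ + 1) formally as twice the sum of (-1)ʲ⁻¹
-- exp((2j - 1)t) over j ≥ 1. Cut off at j = p, half of this expansion is the Euler series times (1
-- + exp(2pt))/2, and modulo p every coefficient of tᵏ/k! in exp(2pt) beyond the constant one
-- vanishes. All computation takes place in ℤ: 1/k stands for an integer inverse of k modulo p, so
-- that each congruence reduces to a polynomial identity between known differences. Rationals are
-- reduced modulo p only at the very end. The Fermat quotient is the one place where a congruence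
-- modulo p is too coarse: a division by p has to be carried out exactly before reducing. The prime
-- 3 stands apart, because Σ_{j≤n} 1/j² ≡ 0 is obtained from three times that sum, and is false for
-- p = 3.

module Integers where
  open import Data.Integer using (-_; _+_; _-_; _*_; _^_; ∣_∣)
  open import Data.Integer.Divisibility.Signed using (_∣_)
  open import Data.Rational using (ℚ; mkℚ; toℚᵘ; ↥_; ↧ₙ_)

  -- Finite sums with index starting at 1

  ∑ : (ℕ → ℤ) → ℕ → ℤ
  ∑ f zero    = 0ℤ
  ∑ f (suc n) = ∑ f n + f (suc n)

  ∑-+ : ∀ f g n → ∑ (λ j → f j + g j) n ≡ ∑ f n + ∑ g n
  ∑-+ f g zero    = refl
  ∑-+ f g (suc n) rewrite ∑-+ f g n = interchange (∑ f n) (∑ g n) (f (suc n)) (g (suc n))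
    where
    interchange : ∀ a b c d → a + b + (c + d) ≡ a + c + (b + d)
    interchange = solve-∀

  ∑-*ˡ : ∀ c f n → ∑ (λ j → c * f j) n ≡ c * ∑ f n
  ∑-*ˡ c f zero    = sym (*-zeroʳ c)
  ∑-*ˡ c f (suc n) rewrite ∑-*ˡ c f n = sym (*-distribˡ-+ c (∑ f n) (f (suc n)))

  -- Made for Pascal's rule: the part with lowered index contributes its term at 0, which `∑` does
  -- not include.
  ∑-suc-+ : ∀ (f g h : ℕ → ℤ) → (∀ j → h (suc j) ≡ f j + g (suc j)) →
                ∀ n → ∑ h (suc n) ≡ f 0 + ∑ f n + ∑ g (suc n)
  ∑-suc-+ f g h eq zero rewrite eq 0 = lemma (f 0) (g 1)
    where
    lemma : ∀ a b → 0ℤ + (a + b) ≡ a + 0ℤ + (0ℤ + b)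
    lemma = solve-∀
  ∑-suc-+ f g h eq (suc n) rewrite ∑-suc-+ f g h eq n | eq (suc n) =
    lemma (f 0) (∑ f n) (∑ g n + g (suc n)) (f (suc n)) (g (suc (suc n)))
    where
    lemma : ∀ a b c d e → a + b + c + (d + e) ≡ a + (b + d) + (c + e)
    lemma = solve-∀

  -- The binomial transform Σₖ C(n,k) xᵏ f(k), written as (1 + x·shift)ⁿ f evaluated at 0.
  T : ℤ → ℕ → (ℕ → ℤ) → ℤ
  T x zero    f = f 0
  T x (suc n) f = T x n f + x * T x n (f ∘ suc)

  T-cong : ∀ x n {f g} → (∀ k → f k ≡ g k) → T x n f ≡ T x n g
  T-cong x zero    eq = eq 0
  T-cong x (suc n) eq = cong₂ (λ a b → a + x * b) (T-cong x n eq) (T-cong x n (eq ∘ suc))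

  T-+ : ∀ x n f g → T x n (λ k → f k + g k) ≡ T x n f + T x n g
  T-+ x zero    f g = refl
  T-+ x (suc n) f g rewrite T-+ x n f g | T-+ x n (f ∘ suc) (g ∘ suc) =
    lemma x (T x n f) (T x n g) (T x n (f ∘ suc)) (T x n (g ∘ suc))
    where
    lemma : ∀ x a b c d → a + b + x * (c + d) ≡ a + x * c + (b + x * d)
    lemma = solve-∀

  T-*ˡ : ∀ x n c f → T x n (λ k → c * f k) ≡ c * T x n f
  T-*ˡ x zero    c f = refl
  T-*ˡ x (suc n) c f rewrite T-*ˡ x n c f | T-*ˡ x n c (f ∘ suc) = lemma x c (T x n f) (T x n (f ∘ suc))
    where
    lemma : ∀ x c a b → c * a + x * (c * b) ≡ c * (a + x * b)
    lemma = solve-∀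

  T-1 : ∀ x n → T x n (λ _ → 1ℤ) ≡ (1ℤ + x) ^ n
  T-1 x zero    = refl
  T-1 x (suc n) rewrite T-1 x n = lemma x ((1ℤ + x) ^ n)
    where
    lemma : ∀ x a → a + x * a ≡ (1ℤ + x) * a
    lemma = solve-∀

  -- This is k C(n+1,k) = (n+1) C(n,k-1) summed over k, obtained from the operator form without
  -- binomial coefficients.
  T-absorb : ∀ x n f → T x (suc n) (λ k → + k * f k) ≡ + suc n * (x * T x n (f ∘ suc))
  T-absorb x zero    f = lemma x (f 0) (f 1)
    where
    lemma : ∀ x a b → 0ℤ * a + x * (1ℤ * b) ≡ 1ℤ * (x * b)
    lemma = solve-∀
  T-absorb x (suc n) f = begin
    T x (suc n) (λ k → + k * f k) + x * T x (suc n) (λ k → + suc k * f (suc k))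
      ≡⟨ cong₂ (λ a b → a + x * b) (T-absorb x n f)
           (trans (T-cong x (suc n) (λ k → suc-* (+ k) (f (suc k))))
             (trans (T-+ x (suc n) (f ∘ suc) (λ k → + k * f (suc k)))
               (cong (λ z → T x (suc n) (f ∘ suc) + z) (T-absorb x n (f ∘ suc))))) ⟩
    + suc n * (x * a) + x * (a + x * b + + suc n * (x * b))
      ≡⟨ lemma x (+ suc n) a b ⟩
    + suc (suc n) * (x * (a + x * b)) ∎
    where
    open ≡-Reasoning
    a = T x n (f ∘ suc)
    b = T x n (f ∘ suc ∘ suc)
    lemma : ∀ x m a b → m * (x * a) + x * (a + x * b + m * (x * b)) ≡ (1ℤ + m) * (x * (a + x * b))
    lemma = solve-∀

  -- Integer binomial coefficients

  binom : ℕ → ℕ → ℤ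
  binom n       zero    = 1ℤ
  binom zero    (suc k) = 0ℤ
  binom (suc n) (suc k) = binom n k + binom n (suc k)

  C≡binom : ∀ n k → + (n C k) ≡ binom n k
  C≡binom n       zero    = refl
  C≡binom zero    (suc k) = refl
  C≡binom (suc n) (suc k) = trans (cong +_ (sym (nCk+nC[k+1]≡[n+1]C[k+1] n k)))
    (trans (pos-+ (n C k) (n C suc k)) (cong₂ _+_ (C≡binom n k) (C≡binom n (suc k))))

  binom-> : ∀ {n k} → n ℕ.< k → binom n k ≡ 0ℤ
  binom-> {zero}  {suc k} _          = refl
  binom-> {suc n} {suc k} (s≤s n<k) = cong₂ _+_ (binom-> n<k) (binom-> (ℕ.m<n⇒m<1+n n<k))

  binom-diag : ∀ n → binom n n ≡ 1ℤ
  binom-diag zero    = refl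
  binom-diag (suc n) = cong₂ _+_ (binom-diag n) (binom-> (ℕ.n<1+n n))

  T-binomial : ∀ x n f → T x n f ≡ f 0 + ∑ (λ k → binom n k * x ^ k * f k) n
  T-binomial x zero    f = sym (+-identityʳ (f 0))
  T-binomial x (suc n) f = begin
    T x n f + x * T x n (f ∘ suc)
      ≡⟨ cong₂ (λ a b → a + x * b) (T-binomial x n f) (T-binomial x n (f ∘ suc)) ⟩
    f 0 + ∑ u n + x * (f 1 + ∑ v n)
      ≡⟨ lemma (f 0) (∑ u n) x (f 1) (∑ v n) ⟩
    f 0 + (x * (1ℤ * 1ℤ * f 1) + x * ∑ v n + (∑ u n + 0ℤ))
      ≡⟨ cong₂ (λ a b → f 0 + (x * (1ℤ * 1ℤ * f 1) + a + (∑ u n + b))) (∑-*ˡ x v n) last≡0 ⟨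
    f 0 + (x * v 0 + ∑ (λ k → x * v k) n + ∑ u (suc n))
      ≡⟨ cong (λ z → f 0 + z) (∑-suc-+ (λ k → x * v k) u (λ k → binom (suc n) k * x ^ k * f k) split n) ⟨
    f 0 + ∑ (λ k → binom (suc n) k * x ^ k * f k) (suc n) ∎
    where
    open ≡-Reasoning
    u v : ℕ → ℤ
    u k = binom n k * x ^ k * f k
    v k = binom n k * x ^ k * f (suc k)
    last≡0 : u (suc n) ≡ 0ℤ
    last≡0 = cong (λ b → b * x ^ suc n * f (suc n)) (binom-> (ℕ.n<1+n n))
    lemma : ∀ a b x c d → a + b + x * (c + d) ≡ a + (x * (1ℤ * 1ℤ * c) + x * d + (b + 0ℤ))
    lemma = solve-∀
    split : ∀ k → binom (suc n) (suc k) * x ^ suc k * f (suc k) ≡ x * v k + u (suc k)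
    split k = lemma₂ (binom n k) (binom n (suc k)) x (x ^ k) (f (suc k))
      where
      lemma₂ : ∀ a b x y c → (a + b) * (x * y) * c ≡ x * (a * y * c) + b * (x * y) * c
      lemma₂ = solve-∀

  binomial-theorem : ∀ x n → (1ℤ + x) ^ n ≡ 1ℤ + ∑ (λ k → binom n k * x ^ k) n
  binomial-theorem x n = trans (sym (T-1 x n)) (trans (T-binomial x n (λ _ → 1ℤ))
    (cong (λ z → 1ℤ + z) (go n)))
    where
    go : ∀ m → ∑ (λ k → binom n k * x ^ k * 1ℤ) m ≡ ∑ (λ k → binom n k * x ^ k) m
    go zero    = refl
    go (suc m) = cong₂ _+_ (go m) (*-identityʳ _)

  binom-absorb : ∀ n k → + suc k * binom (suc n) (suc k) ≡ + suc n * binom n k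
  binom-absorb zero    zero    = refl
  binom-absorb zero    (suc k) = *-zeroʳ (+ suc (suc k))
  binom-absorb (suc n) zero    = lemma (+ suc n) _ (binom-absorb n zero)
    where
    lemma : ∀ m a → 1ℤ * a ≡ m * 1ℤ → 1ℤ * (1ℤ + a) ≡ (1ℤ + m) * 1ℤ
    lemma m a eq = trans (*-distribˡ-+ 1ℤ 1ℤ a) (trans (cong (λ z → 1ℤ + z) eq) (sym (*-distribʳ-+ 1ℤ 1ℤ m)))
  binom-absorb (suc n) (suc k) = begin
    + suc (suc k) * (a + b)                ≡⟨ lemma₁ (+ suc k) a b ⟩
    a + + suc k * a + + suc (suc k) * b    ≡⟨ cong₂ (λ x y → a + x + y) (binom-absorb n k) (binom-absorb n (suc k)) ⟩
    a + + suc n * c + + suc n * d          ≡⟨ lemma₂ c d (+ suc n) ⟩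
    + suc (suc n) * a                      ∎
    where
    open ≡-Reasoning
    a = binom (suc n) (suc k)
    b = binom (suc n) (suc (suc k))
    c = binom n k
    d = binom n (suc k)
    lemma₁ : ∀ k a b → (1ℤ + k) * (a + b) ≡ a + k * a + (1ℤ + k) * b
    lemma₁ = solve-∀
    lemma₂ : ∀ c d n → c + d + n * c + n * d ≡ (1ℤ + n) * (c + d)
    lemma₂ = solve-∀

  binom-step : ∀ n k → + suc k * binom n (suc k) ≡ (+ n - + k) * binom n k
  binom-step n k = begin
    + suc k * b                          ≡⟨ lemma₁ (+ suc k) a b ⟩
    + suc k * (a + b) - + suc k * a      ≡⟨ cong (_- + suc k * a) (binom-absorb n k) ⟩
    + suc n * a - + suc k * a            ≡⟨ lemma₂ (+ n) (+ k) a ⟩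
    (+ n - + k) * a                      ∎
    where
    open ≡-Reasoning
    a = binom n k
    b = binom n (suc k)
    lemma₁ : ∀ k a b → k * b ≡ k * (a + b) - k * a
    lemma₁ = solve-∀
    lemma₂ : ∀ n k a → (1ℤ + n) * a - (1ℤ + k) * a ≡ (n - k) * a
    lemma₂ = solve-∀

  ∑-≡ : ∀ {f g} n → (∀ j → f j ≡ g j) → ∑ f n ≡ ∑ g n
  ∑-≡ zero    eq = refl
  ∑-≡ (suc n) eq = cong₂ _+_ (∑-≡ n eq) (eq (suc n))

  s-double : ∀ n → -1ℤ ^ (n ℕ.+ n) ≡ 1ℤ
  s-double zero = refl
  s-double (suc n) = trans (cong (-1ℤ ^_) (cong suc (ℕ.+-suc n n)))
    (trans (lemma (-1ℤ ^ (n ℕ.+ n))) (s-double n))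
    where
    lemma : ∀ x → -1ℤ * (-1ℤ * x) ≡ x
    lemma = solve-∀

  -- The weight 1 + (-1)ʲ is 2 at even j and 0 at odd j.
  ∑-even : ∀ f n → ∑ f (n ℕ.+ n) + ∑ (λ j → -1ℤ ^ j * f j) (n ℕ.+ n) ≡ + 2 * ∑ (λ j → f (j ℕ.+ j)) n
  ∑-even f zero    = refl
  ∑-even f (suc n) rewrite ℕ.+-suc n n = trans
    (lemma (∑ f (n ℕ.+ n)) (∑ (λ j → -1ℤ ^ j * f j) (n ℕ.+ n)) (-1ℤ ^ (n ℕ.+ n)) (f (suc (n ℕ.+ n))) (f (suc (suc (n ℕ.+ n)))))
    (trans (cong₂ (λ x e → x + (1ℤ - e) * f (suc (n ℕ.+ n)) + (1ℤ + e) * f (suc (suc (n ℕ.+ n)))) (∑-even f n) (s-double n))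
    (lemma₂ (∑ (λ j → f (j ℕ.+ j)) n) (f (suc (n ℕ.+ n))) (f (suc (suc (n ℕ.+ n))))))
    where
    lemma : ∀ a b s x y → a + x + y + (b + -1ℤ * s * x + -1ℤ * (-1ℤ * s) * y) ≡ a + b + (1ℤ - s) * x + (1ℤ + s) * y
    lemma = solve-∀
    lemma₂ : ∀ a x y → + 2 * a + (1ℤ - 1ℤ) * x + (1ℤ + 1ℤ) * y ≡ + 2 * (a + y)
    lemma₂ = solve-∀

  s-square : ∀ n → -1ℤ ^ n * -1ℤ ^ n ≡ 1ℤ
  s-square n = trans (sym (^-distribˡ-+-* -1ℤ n n)) (s-double n)

  -- The square of index pairs is covered by the triangles i ≤ j and j ≤ i, which overlap in the
  -- diagonal.
  ∑-product : ∀ f g n → ∑ (λ j → f j * ∑ g j) n + ∑ (λ j → g j * ∑ f j) n ≡ ∑ f n * ∑ g n + ∑ (λ j → f j * g j) n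
  ∑-product f g zero    = refl
  ∑-product f g (suc n) = trans (lemma₁ (∑ (λ j → f j * ∑ g j) n) (∑ (λ j → g j * ∑ f j) n) (∑ f n) (f (suc n)) (∑ g n) (g (suc n)))
    (trans (cong (λ z → z + (f (suc n) * ∑ g (suc n) + g (suc n) * ∑ f (suc n))) (∑-product f g n))
      (lemma₂ (∑ f n) (f (suc n)) (∑ g n) (g (suc n)) (∑ (λ j → f j * g j) n)))
    where
    lemma₁ : ∀ a b F f G g → a + f * (G + g) + (b + g * (F + f)) ≡ a + b + (f * (G + g) + g * (F + f))
    lemma₁ = solve-∀
    lemma₂ : ∀ F f G g c → F * G + c + (f * (G + g) + g * (F + f)) ≡ (F + f) * (G + g) + (c + f * g)
    lemma₂ = solve-∀

  binom-central : ∀ k → + suc k * binom (suc k ℕ.+ suc k) (suc k) ≡ + 2 * (+ suc (k ℕ.+ k) * binom (k ℕ.+ k) k)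
  binom-central k = *-cancelˡ-≡ (+ suc k) _ _ (begin
    + suc k * (+ suc k * binom (suc k ℕ.+ suc k) (suc k))
      ≡⟨ cong (+ suc k *_) (trans (cong (λ z → + suc k * binom (suc z) (suc k)) (ℕ.+-suc k k)) (binom-absorb (suc (k ℕ.+ k)) k)) ⟩
    + suc k * (+ suc (suc (k ℕ.+ k)) * x)
      ≡⟨ lemma₁ (+ k) x ⟩
    + 2 * (+ suc k * ((+ suc (k ℕ.+ k) - + k) * x))
      ≡⟨ cong (λ z → + 2 * (+ suc k * z)) (trans (sym (binom-step (suc (k ℕ.+ k)) k)) (binom-absorb (k ℕ.+ k) k)) ⟩
    + 2 * (+ suc k * (+ suc (k ℕ.+ k) * binom (k ℕ.+ k) k))
      ≡⟨ lemma₂ (+ suc k) (+ suc (k ℕ.+ k) * binom (k ℕ.+ k) k) ⟩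
    + suc k * (+ 2 * (+ suc (k ℕ.+ k) * binom (k ℕ.+ k) k)) ∎)
    where
    open ≡-Reasoning
    x = binom (suc (k ℕ.+ k)) k
    lemma₁ : ∀ k x → (1ℤ + k) * ((+ 2 + (k + k)) * x) ≡ + 2 * ((1ℤ + k) * ((1ℤ + (k + k) - k) * x))
    lemma₁ = solve-∀
    lemma₂ : ∀ k x → + 2 * (k * x) ≡ k * (+ 2 * x)
    lemma₂ = solve-∀

  pos-^ : ∀ m n → + (m ℕ.^ n) ≡ (+ m) ^ n
  pos-^ m zero    = refl
  pos-^ m (suc n) = trans (pos-* m (m ℕ.^ n)) (cong (+ m *_) (pos-^ m n))

  2^n∸1 : ∀ n → + (2 ℕ.^ n ∸ 1) ≡ (+ 2) ^ n - 1ℤ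
  2^n∸1 n = trans (sym (trans (m-n≡m⊖n (2 ℕ.^ n) 1) (⊖-≥ (ℕ.m^n>0 2 n)))) (cong (_- 1ℤ) (pos-^ 2 n))

  -- Euler numbers and alternating power sums

  last-∷ʳ : ∀ xs x → last (xs ∷ʳ x) ≡ x
  last-∷ʳ []           x = refl
  last-∷ʳ (y ∷ [])     x = refl
  last-∷ʳ (y ∷ z ∷ xs) x = last-∷ʳ (z ∷ xs) x

  eulerList≡map-E : ∀ n → eulerList n ≡ map E (upTo (suc n))
  eulerList≡map-E zero    = refl
  eulerList≡map-E (suc n) = begin
    eulerList (suc n)                              ≡⟨ cong (λ x → eulerList n ++ x ∷ []) (sym (last-∷ʳ (eulerList n) _)) ⟩
    eulerList n ++ (E (suc n) ∷ [])                ≡⟨ cong (λ xs → xs ++ E (suc n) ∷ []) (eulerList≡map-E n) ⟩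
    map E (upTo (suc n)) ++ (E (suc n) ∷ [])       ≡⟨ map-++ E (upTo (suc n)) (suc n ∷ []) ⟨
    map E (upTo (suc n) ∷ʳ suc n)                  ≡⟨ cong (map E) (upTo-∷ʳ (suc n)) ⟩
    map E (upTo (suc (suc n)))                     ∎
    where open ≡-Reasoning

  zipWith-map-self : ∀ {A B C : Set} (f : A → B → C) (g : A → B) xs → zipWith f xs (map g xs) ≡ map (λ x → f x (g x)) xs
  zipWith-map-self f g []       = refl
  zipWith-map-self f g (x ∷ xs) = cong (f x (g x) ∷_) (zipWith-map-self f g xs)

  sumℤ-∷ʳ : ∀ xs x → sumℤ (xs ∷ʳ x) ≡ sumℤ xs + x
  sumℤ-∷ʳ []       x = trans (+-identityʳ x) (sym (+-identityˡ x))
  sumℤ-∷ʳ (y ∷ xs) x = trans (cong (λ z → y + z) (sumℤ-∷ʳ xs x)) (sym (+-assoc y (sumℤ xs) x))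

  sumℤ-upTo : ∀ f n → sumℤ (map f (upTo (suc n))) ≡ f 0 + ∑ f n
  sumℤ-upTo f zero    = refl
  sumℤ-upTo f (suc n) = begin
    sumℤ (map f (upTo (suc (suc n))))        ≡⟨ cong (λ xs → sumℤ (map f xs)) (upTo-∷ʳ (suc n)) ⟨
    sumℤ (map f (upTo (suc n) ∷ʳ suc n))     ≡⟨ cong sumℤ (map-++ f (upTo (suc n)) (suc n ∷ [])) ⟩
    sumℤ (map f (upTo (suc n)) ∷ʳ f (suc n)) ≡⟨ sumℤ-∷ʳ (map f (upTo (suc n))) (f (suc n)) ⟩
    sumℤ (map f (upTo (suc n))) + f (suc n)  ≡⟨ cong (_+ f (suc n)) (sumℤ-upTo f n) ⟩
    f 0 + ∑ f n + f (suc n)                  ≡⟨ +-assoc (f 0) (∑ f n) (f (suc n)) ⟩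
    f 0 + ∑ f (suc n)                        ∎
    where open ≡-Reasoning

  E-summand : ℕ → ℕ → ℤ → ℤ
  E-summand n k e = if ((suc n ∸ k) % 2 ≡ᵇ 0) then (+ (suc n C k)) * e else + 0

  E-suc : ∀ n → E (suc n) ≡ - (E-summand n 0 (E 0) + ∑ (λ k → E-summand n k (E k)) n)
  E-suc n = begin
    E (suc n)
      ≡⟨ last-∷ʳ (eulerList n) _ ⟩
    - sumℤ (zipWith (E-summand n) (upTo (suc n)) (eulerList n))
      ≡⟨ cong (λ xs → - sumℤ (zipWith (E-summand n) (upTo (suc n)) xs)) (eulerList≡map-E n) ⟩
    - sumℤ (zipWith (E-summand n) (upTo (suc n)) (map E (upTo (suc n))))
      ≡⟨ cong (λ xs → - sumℤ xs) (zipWith-map-self (E-summand n) E (upTo (suc n))) ⟩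
    - sumℤ (map (λ k → E-summand n k (E k)) (upTo (suc n)))
      ≡⟨ cong -_ (sumℤ-upTo (λ k → E-summand n k (E k)) n) ⟩
    - (E-summand n 0 (E 0) + ∑ (λ k → E-summand n k (E k)) n) ∎
    where open ≡-Reasoning

  -- Doubling trades the parity test for a sign, which ring identities can handle; the factor 2 is
  -- cancelled modulo p later.
  if-even : ∀ j x → + 2 * (if (j % 2 ≡ᵇ 0) then x else 0ℤ) ≡ (1ℤ + -1ℤ ^ j) * x
  if-even zero          x = refl
  if-even (suc zero)    x = refl
  if-even (suc (suc j)) x = trans (if-even j x) (cong (λ z → (1ℤ + z) * x) (lemma (-1ℤ ^ j)))
    where
    lemma : ∀ s → s ≡ -1ℤ * (-1ℤ * s)
    lemma = solve-∀

  s-∸ : ∀ {n k} → k ℕ.≤ n → -1ℤ ^ (n ∸ k) ≡ -1ℤ ^ n * -1ℤ ^ k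
  s-∸ {n} {k} k≤n = begin
    -1ℤ ^ (n ∸ k)                       ≡⟨ *-identityʳ _ ⟨
    -1ℤ ^ (n ∸ k) * 1ℤ                  ≡⟨ cong (-1ℤ ^ (n ∸ k) *_) (s-square k) ⟨
    -1ℤ ^ (n ∸ k) * (-1ℤ ^ k * -1ℤ ^ k) ≡⟨ *-assoc (-1ℤ ^ (n ∸ k)) (-1ℤ ^ k) (-1ℤ ^ k) ⟨
    -1ℤ ^ (n ∸ k) * -1ℤ ^ k * -1ℤ ^ k   ≡⟨ cong (_* -1ℤ ^ k) (^-distribˡ-+-* -1ℤ (n ∸ k) k) ⟨
    -1ℤ ^ (n ∸ k ℕ.+ k) * -1ℤ ^ k       ≡⟨ cong (λ z → -1ℤ ^ z * -1ℤ ^ k) (ℕ.m∸n+n≡m k≤n) ⟩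
    -1ℤ ^ n * -1ℤ ^ k                   ∎
    where open ≡-Reasoning

  *-^ : ∀ x y n → (x * y) ^ n ≡ x ^ n * y ^ n
  *-^ x y zero    = refl
  *-^ x y (suc n) = trans (cong (x * y *_) (*-^ x y n)) (lemma x y (x ^ n) (y ^ n))
    where
    lemma : ∀ x y z t → x * y * (z * t) ≡ x * z * (y * t)
    lemma = solve-∀

  -- On a geometric sequence the shift acts as multiplication by `y`.
  T-^ : ∀ x n c y → T x n (λ k → c * y ^ k) ≡ c * (1ℤ + x * y) ^ n
  T-^ x zero    c y = refl
  T-^ x (suc n) c y = trans
    (cong₂ (λ u v → u + x * v) (T-^ x n c y)
      (trans (T-cong x n (λ k → sym (*-assoc c y (y ^ k)))) (T-^ x n (c * y) y)))
    (lemma x c y ((1ℤ + x * y) ^ n))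
    where
    lemma : ∀ x c y z → c * z + x * (c * y * z) ≡ c * ((1ℤ + x * y) * z)
    lemma = solve-∀

  T-∑ : ∀ x n (f : ℕ → ℕ → ℤ) M → T x n (λ k → ∑ (λ j → f j k) M) ≡ ∑ (λ j → T x n (f j)) M
  T-∑ x zero    f M = refl
  T-∑ x (suc n) f M = trans (cong₂ (λ u v → u + x * v) (T-∑ x n f M) (T-∑ x n (λ j k → f j (suc k)) M))
    (trans (cong (λ z → ∑ (λ j → T x n (f j)) M + z) (sym (∑-*ˡ x (λ j → T x n (f j ∘ suc)) M)))
      (sym (∑-+ (λ j → T x n (f j)) (λ j → x * T x n (f j ∘ suc)) M)))

  odd : ℕ → ℤ
  odd j = + j + + j - 1ℤ

  -- At M = p this is congruent to the Euler number E_k modulo p.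
  altPowerSum : ℕ → ℕ → ℤ
  altPowerSum M k = ∑ (λ j → - (-1ℤ ^ j) * odd j ^ k) M

  -- With r = n + 1, the two transforms turn (2j - 1)ᵏ into (2j)ʳ and (2j - 2)ʳ, and the alternating
  -- signs make neighbouring j cancel. The left side weights C(r,k) by 1 + (-1)ʳ⁻ᵏ: it is twice the
  -- sum in the recursion for the Euler numbers.
  altPowerSum-T : ∀ M n →
    T 1ℤ (suc n) (altPowerSum M) + -1ℤ ^ suc n * T 1ℤ (suc n) (λ k → -1ℤ ^ k * altPowerSum M k) ≡
    - (-1ℤ ^ M) * (+ M + + M) ^ suc n
  altPowerSum-T M n = begin
    T 1ℤ r (altPowerSum M) + -1ℤ ^ r * T 1ℤ r (λ k → -1ℤ ^ k * altPowerSum M k)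
      ≡⟨ cong₂ (λ u v → u + -1ℤ ^ r * v) (T-∑ 1ℤ r (λ j k → t j * odd j ^ k) M)
           (trans (T-cong 1ℤ r (λ k → sym (∑-*ˡ (-1ℤ ^ k) (λ j → t j * odd j ^ k) M)))
             (T-∑ 1ℤ r (λ j k → -1ℤ ^ k * (t j * odd j ^ k)) M)) ⟩
    ∑ (λ j → T 1ℤ r (λ k → t j * odd j ^ k)) M + -1ℤ ^ r * ∑ (λ j → T 1ℤ r (λ k → -1ℤ ^ k * (t j * odd j ^ k))) M
      ≡⟨ cong₂ (λ u v → u + -1ℤ ^ r * v) (∑-≡ M (λ j → T-^ 1ℤ r (t j) (odd j)))
           (∑-≡ M (λ j → trans (T-cong 1ℤ r (negate j)) (T-^ 1ℤ r (t j) (-1ℤ * odd j)))) ⟩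
    ∑ (λ j → t j * (1ℤ + 1ℤ * odd j) ^ r) M + -1ℤ ^ r * ∑ (λ j → t j * (1ℤ + 1ℤ * (-1ℤ * odd j)) ^ r) M
      ≡⟨ telescope M ⟩
    t M * (+ M + + M) ^ r ∎
    where
    open ≡-Reasoning
    r = suc n
    t : ℕ → ℤ
    t j = - (-1ℤ ^ j)
    negate : ∀ j k → -1ℤ ^ k * (t j * odd j ^ k) ≡ t j * (-1ℤ * odd j) ^ k
    negate j k = trans (lemma (-1ℤ ^ k) (t j) (odd j ^ k)) (cong (t j *_) (sym (*-^ -1ℤ (odd j) k)))
      where
      lemma : ∀ x y z → x * (y * z) ≡ y * (x * z)
      lemma = solve-∀
    telescope : ∀ M → ∑ (λ j → t j * (1ℤ + 1ℤ * odd j) ^ r) M + -1ℤ ^ r * ∑ (λ j → t j * (1ℤ + 1ℤ * (-1ℤ * odd j)) ^ r) M ≡ t M * (+ M + + M) ^ r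
    -- The exponent r is positive, so the boundary term (0 + 0)ʳ is 0.
    telescope zero    = trans (+-identityˡ _) (*-zeroʳ (-1ℤ ^ r))
    telescope (suc M) = begin
      x + t (suc M) * (1ℤ + 1ℤ * odd (suc M)) ^ r + -1ℤ ^ r * (y + t (suc M) * (1ℤ + 1ℤ * (-1ℤ * odd (suc M))) ^ r)
        ≡⟨ lemma₁ x (t (suc M)) ((1ℤ + 1ℤ * odd (suc M)) ^ r) (-1ℤ ^ r) y ((1ℤ + 1ℤ * (-1ℤ * odd (suc M))) ^ r) ⟩
      x + -1ℤ ^ r * y + (t (suc M) * (1ℤ + 1ℤ * odd (suc M)) ^ r + t (suc M) * (-1ℤ ^ r * (1ℤ + 1ℤ * (-1ℤ * odd (suc M))) ^ r))
        ≡⟨ cong₂ _+_ (telescope M) (cong₂ (λ u v → t (suc M) * u + t (suc M) * v) (cong (_^ r) (lemma₂ (+ M)))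
             (trans (sym (*-^ -1ℤ (1ℤ + 1ℤ * (-1ℤ * odd (suc M))) r)) (cong (_^ r) (lemma₃ (+ M))))) ⟩
      t M * (+ M + + M) ^ r + (t (suc M) * (+ suc M + + suc M) ^ r + t (suc M) * (+ M + + M) ^ r)
        ≡⟨ lemma₄ (-1ℤ ^ M) ((+ M + + M) ^ r) (t (suc M) * (+ suc M + + suc M) ^ r) ⟩
      t (suc M) * (+ suc M + + suc M) ^ r ∎
      where
      x = ∑ (λ j → t j * (1ℤ + 1ℤ * odd j) ^ r) M
      y = ∑ (λ j → t j * (1ℤ + 1ℤ * (-1ℤ * odd j)) ^ r) M
      lemma₁ : ∀ x t u s y v → x + t * u + s * (y + t * v) ≡ x + s * y + (t * u + t * (s * v))
      lemma₁ = solve-∀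
      lemma₂ : ∀ m → 1ℤ + 1ℤ * ((1ℤ + m) + (1ℤ + m) - 1ℤ) ≡ (1ℤ + m) + (1ℤ + m)
      lemma₂ = solve-∀
      lemma₃ : ∀ m → -1ℤ * (1ℤ + 1ℤ * (-1ℤ * ((1ℤ + m) + (1ℤ + m) - 1ℤ))) ≡ m + m
      lemma₃ = solve-∀
      lemma₄ : ∀ s u v → - s * u + (v + - (-1ℤ * s) * u) ≡ v
      lemma₄ = solve-∀

  2E-summand : ∀ n k → k ℕ.≤ n → ∀ e →
    + 2 * E-summand n k e ≡ (1ℤ + -1ℤ ^ suc n * -1ℤ ^ k) * (binom (suc n) k * e)
  2E-summand n k k≤n e = trans (if-even (suc n ∸ k) (+ (suc n C k) * e))
    (cong₂ (λ u v → (1ℤ + u) * (v * e)) (s-∸ (ℕ.m≤n⇒m≤1+n k≤n)) (C≡binom (suc n) k))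

  -- Congruences modulo p

  module Congruence (p : ℕ) where

    infix 4 _≈_
    -- A record, so that unification recovers both sides from the type of a proof; the bare
    -- divisibility of a difference would not determine them.
    record _≈_ (a b : ℤ) : Set where
      constructor by-∣
      field p∣a-b : + p ∣ a - b

    open _≈_ public

    infix 6 _·_
    infixl 5 _⊞_

    -- A congruence is proved by `combine (k · h ⊞ l · h′ ⊞ …) e`, where the ring identity e writes
    -- the difference of its two sides as a linear combination of known differences.
    _·_ : ∀ k {a b} → a ≈ b → + p ∣ k * (a - b)
    k · by-∣ e = ∣n⇒∣m*n k e

    _⊞_ : ∀ {x y} → + p ∣ x → + p ∣ y → + p ∣ x + y
    _⊞_ = ∣m∣n⇒∣m+n

    combine : ∀ {a b x} → + p ∣ x → a - b ≡ x → a ≈ b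
    combine e eq = by-∣ (subst (+ p ∣_) (sym eq) e)

    ≈-refl : ∀ {a} → a ≈ a
    ≈-refl {a} = combine (∣n⇒∣m*n 0ℤ ∣-refl) (+-inverseʳ a)

    ≡⇒≈ : ∀ {a b} → a ≡ b → a ≈ b
    ≡⇒≈ refl = ≈-refl

    ≈-sym : ∀ {a b} → a ≈ b → b ≈ a
    ≈-sym {a} {b} h = combine (-1ℤ · h) (lemma a b)
      where
      lemma : ∀ a b → b - a ≡ -1ℤ * (a - b)
      lemma = solve-∀

    ≈-trans : ∀ {a b c} → a ≈ b → b ≈ c → a ≈ c
    ≈-trans {a} {b} {c} h k = combine (1ℤ · h ⊞ 1ℤ · k) (lemma a b c)
      where
      lemma : ∀ a b c → a - c ≡ 1ℤ * (a - b) + 1ℤ * (b - c)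
      lemma = solve-∀

    ≈-setoid : Setoid 0ℓ 0ℓ
    ≈-setoid = record { Carrier = ℤ ; _≈_ = _≈_ ; isEquivalence = record { refl = ≈-refl ; sym = ≈-sym ; trans = ≈-trans } }

    +-cong : ∀ {a b c d} → a ≈ b → c ≈ d → a + c ≈ b + d
    +-cong {a} {b} {c} {d} h k = combine (1ℤ · h ⊞ 1ℤ · k) (lemma a b c d)
      where
      lemma : ∀ a b c d → a + c - (b + d) ≡ 1ℤ * (a - b) + 1ℤ * (c - d)
      lemma = solve-∀

    *-cong : ∀ {a b c d} → a ≈ b → c ≈ d → a * c ≈ b * d
    *-cong {a} {b} {c} {d} h k = combine (c · h ⊞ b · k) (lemma a b c d)
      where
      lemma : ∀ a b c d → a * c - b * d ≡ c * (a - b) + b * (c - d)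
      lemma = solve-∀

    *-congˡ : ∀ c {a b} → a ≈ b → c * a ≈ c * b
    *-congˡ c = *-cong (≈-refl {c})

    +-congˡ : ∀ c {a b} → a ≈ b → c + a ≈ c + b
    +-congˡ c = +-cong (≈-refl {c})

    p≈0 : + p ≈ 0ℤ
    p≈0 = combine ∣-refl (+-identityʳ (+ p))

    ∑-cong : ∀ f g n → (∀ j → j ℕ.< n → f (suc j) ≈ g (suc j)) → ∑ f n ≈ ∑ g n
    ∑-cong f g zero    h = ≈-refl
    ∑-cong f g (suc n) h = +-cong (∑-cong f g n (λ j j<n → h j (ℕ.m<n⇒m<1+n j<n))) (h n (ℕ.n<1+n n))

    T-cong≈ : ∀ x n {f g} → (∀ k → k ℕ.≤ n → f k ≈ g k) → T x n f ≈ T x n g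
    T-cong≈ x zero    h = h 0 z≤n
    T-cong≈ x (suc n) h = +-cong (T-cong≈ x n (λ k k≤n → h k (ℕ.m≤n⇒m≤1+n k≤n)))
      (*-congˡ x (T-cong≈ x n (λ k k≤n → h (suc k) (s≤s k≤n))))

    -- Under j ↦ M + 1 - j the first i terms of `g` become the terms of `f` above k. For i = k this
    -- folds a full sum onto its lower half.
    ∑-reflect : ∀ f g M → (∀ i k → suc (i ℕ.+ k) ≡ M → f (suc k) ≈ g (suc i)) →
                ∀ i k → i ℕ.+ k ≡ M → ∑ f k + ∑ g i ≈ ∑ f M
    ∑-reflect f g M h zero    k refl = ≡⇒≈ (+-identityʳ (∑ f k))
    ∑-reflect f g M h (suc i) k eq = combine
      (-1ℤ · h i k eq ⊞ 1ℤ · ∑-reflect f g M h i (suc k) (trans (ℕ.+-suc i k) eq))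
      (lemma (∑ f k) (∑ g i) (f (suc k)) (g (suc i)) (∑ f M))
      where
      lemma : ∀ a b x y c → a + (b + y) - c ≡ -1ℤ * (x - y) + 1ℤ * (a + x + b - c)
      lemma = solve-∀

    ∑-reverse : ∀ f g M → (∀ i k → suc (i ℕ.+ k) ≡ M → f (suc k) ≈ g (suc i)) → ∑ g M ≈ ∑ f M
    ∑-reverse f g M h = ≈-trans (≡⇒≈ (sym (+-identityˡ (∑ g M)))) (∑-reflect f g M h M 0 (ℕ.+-identityʳ M))

  -- Fermat's little theorem

  euclid : ∀ {p} → Prime p → ∀ x y → + p ∣ x * y → (+ p ∣ x) ⊎ (+ p ∣ y)
  euclid {p} p-prime x y h = Sum.map ∣ᵤ⇒∣ ∣ᵤ⇒∣ (euclidsLemma ∣ x ∣ ∣ y ∣ p-prime (subst (p ℕ.∣_) (abs-* x y) (∣⇒∣ᵤ h)))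

  module Fermat (N : ℕ) (p-prime : Prime (suc N)) where
    open Congruence (suc N)
    open Relation.Binary.Reasoning.Setoid ≈-setoid

    p∤ : ∀ k → k ℕ.< N → ¬ (+ suc N ∣ + suc k)
    p∤ k k<N = ℕ.>⇒∤ (s≤s k<N) ∘ ∣⇒∣ᵤ

    p∣binom : ∀ k → k ℕ.< N → + suc N ∣ binom (suc N) (suc k)
    p∣binom k k<N with euclid p-prime (+ suc k) (binom (suc N) (suc k))
      (divides (binom N k) (trans (binom-absorb N k) (*-comm (+ suc N) (binom N k))))
    ... | inj₁ p∣k = contradiction p∣k (p∤ k k<N)
    ... | inj₂ p∣C = p∣C

    fermat-little : ∀ a → (+ a) ^ suc N ≈ + a
    fermat-little zero    = ≈-refl
    fermat-little (suc a) = begin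
      (1ℤ + + a) ^ suc N
        ≡⟨ binomial-theorem (+ a) (suc N) ⟩
      1ℤ + (∑ u N + binom (suc N) (suc N) * (+ a) ^ suc N)
        ≈⟨ +-congˡ 1ℤ (+-cong u≈0 (*-cong (≡⇒≈ (binom-diag (suc N))) (fermat-little a))) ⟩
      1ℤ + (0ℤ + 1ℤ * + a)
        ≡⟨ cong (λ z → 1ℤ + z) (trans (+-identityˡ (1ℤ * + a)) (*-identityˡ (+ a))) ⟩
      + suc a ∎
      where
      u : ℕ → ℤ
      u k = binom (suc N) k * (+ a) ^ k
      lemma : ∀ b x → b * x - 0ℤ * x ≡ x * b
      lemma = solve-∀
      u≈0 : ∑ u N ≈ 0ℤ
      u≈0 = ≈-trans
        (∑-cong u (λ j → 0ℤ * (+ a) ^ j) N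
          (λ k k<N → combine (∣n⇒∣m*n ((+ a) ^ suc k) (p∣binom k k<N)) (lemma (binom (suc N) (suc k)) ((+ a) ^ suc k))))
        (≡⇒≈ (∑-*ˡ 0ℤ ((+ a) ^_) N))

    fermat : ∀ k → k ℕ.< N → (+ suc k) ^ N ≈ 1ℤ
    fermat k k<N = Sum.[ (λ p∣k → contradiction p∣k (p∤ k k<N)) , by-∣ ]′
      (euclid p-prime (+ suc k) ((+ suc k) ^ N - 1ℤ)
        (subst (+ suc N ∣_) (lemma (+ suc k) ((+ suc k) ^ N)) (_≈_.p∣a-b (fermat-little (suc k)))))
      where
      lemma : ∀ a x → a * x - a ≡ a * (x - 1ℤ)
      lemma = solve-∀

  -- The hypothesis 2 < N says that 2 and 3 are invertible modulo p = N + 1.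
  module HalfRange (n : ℕ) (2<N : 2 ℕ.< n ℕ.+ n) (p-prime : Prime (suc (n ℕ.+ n)))
    (inv : ℕ → ℤ) (inv-zero : inv 0 ≡ 0ℤ)
    (inv-inverse : ∀ k → k ℕ.< n ℕ.+ n → Congruence._≈_ (suc (n ℕ.+ n)) (+ suc k * inv (suc k)) 1ℤ) where

    -- Inverses and signs under j ↦ p - j

    N : ℕ
    N = n ℕ.+ n

    open Congruence (suc N)
    open Fermat N p-prime
    open Relation.Binary.Reasoning.Setoid ≈-setoid

    cancel : ∀ k → k ℕ.< N → ∀ {a b} → + suc k * a ≈ + suc k * b → a ≈ b
    cancel k k<N {a} {b} h = combine (inv (suc k) · h ⊞ (- (a - b)) · inv-inverse k k<N)
      (lemma a b (+ suc k) (inv (suc k)))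
      where
      lemma : ∀ a b k i → a - b ≡ i * (k * a - k * b) + (- (a - b)) * (k * i - 1ℤ)
      lemma = solve-∀

    1<N : 1 ℕ.< N
    1<N = ℕ.<-trans (ℕ.n<1+n 1) 2<N

    left< : ∀ {i k M} → suc (i ℕ.+ k) ≡ M → i ℕ.< M
    left< {i} {k} refl = s≤s (ℕ.m≤m+n i k)

    right< : ∀ {i k M} → suc (i ℕ.+ k) ≡ M → k ℕ.< M
    right< {i} {k} refl = s≤s (ℕ.m≤n+m k i)

    sum≈0 : ∀ {i k} → suc (i ℕ.+ k) ≡ N → + suc i + + suc k ≈ 0ℤ
    sum≈0 {i} {k} eq = ≈-trans (≡⇒≈ (cong +_ (trans (cong suc (ℕ.+-suc i k)) (cong suc eq)))) p≈0

    inv-neg : ∀ i k → suc (i ℕ.+ k) ≡ N → inv (suc k) ≈ - inv (suc i)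
    inv-neg i k eq = cancel k (right< eq) (combine
      (1ℤ · inv-inverse k (right< eq) ⊞ -1ℤ · inv-inverse i (left< eq) ⊞ inv (suc i) · sum≈0 eq)
      (lemma (+ suc k) (+ suc i) (inv (suc k)) (inv (suc i))))
      where
      lemma : ∀ k i K I → k * K - k * (- I) ≡ 1ℤ * (k * K - 1ℤ) + -1ℤ * (i * I - 1ℤ) + I * (i + k - 0ℤ)
      lemma = solve-∀

    s-neg : ∀ i k → suc (i ℕ.+ k) ≡ N → -1ℤ ^ suc k ≡ - -1ℤ ^ suc i
    s-neg i k eq = trans (lemma (-1ℤ ^ k)) (trans (cong (_* (-1ℤ * -1ℤ ^ k)) (sym (s-square (suc i))))
      (trans (lemma₂ (-1ℤ ^ suc i) (-1ℤ ^ k)) (trans (cong (λ z → -1ℤ ^ suc i * (-1ℤ * z))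
        (trans (sym (^-distribˡ-+-* -1ℤ (suc i) k)) (trans (cong (-1ℤ ^_) eq) (s-double n))))
        (lemma₃ (-1ℤ ^ suc i)))))
      where
      lemma : ∀ x → -1ℤ * x ≡ 1ℤ * (-1ℤ * x)
      lemma = solve-∀
      lemma₂ : ∀ x y → x * x * (-1ℤ * y) ≡ x * (-1ℤ * (x * y))
      lemma₂ = solve-∀
      lemma₃ : ∀ x → x * (-1ℤ * 1ℤ) ≡ - x
      lemma₃ = solve-∀

    -- In the notation of the overview, `∑ a n` represents H_n, `∑ d n` is D, `∑ w n` is X and
    -- `∑ w N` is W.
    a b c d w : ℕ → ℤ
    a j = inv j
    b j = -1ℤ ^ j * inv j
    c j = inv j * inv j
    d j = -1ℤ ^ j * c j
    w j = b j * ∑ a j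

    b-reflect : ∀ i k → suc (i ℕ.+ k) ≡ N → b (suc k) ≈ b (suc i)
    b-reflect i k eq = begin
      -1ℤ ^ suc k * inv (suc k)           ≈⟨ *-cong (≡⇒≈ (s-neg i k eq)) (inv-neg i k eq) ⟩
      (- -1ℤ ^ suc i) * (- inv (suc i))   ≡⟨ lemma (-1ℤ ^ suc i) (inv (suc i)) ⟩
      b (suc i)                           ∎
      where
      lemma : ∀ x y → (- x) * (- y) ≡ x * y
      lemma = solve-∀

    c-reflect : ∀ i k → suc (i ℕ.+ k) ≡ N → c (suc k) ≈ c (suc i)
    c-reflect i k eq = begin
      inv (suc k) * inv (suc k)         ≈⟨ *-cong (inv-neg i k eq) (inv-neg i k eq) ⟩
      (- inv (suc i)) * (- inv (suc i)) ≡⟨ lemma (inv (suc i)) ⟩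
      c (suc i)                         ∎
      where
      lemma : ∀ y → (- y) * (- y) ≡ y * y
      lemma = solve-∀

    d-reflect : ∀ i k → suc (i ℕ.+ k) ≡ N → d (suc k) ≈ - d (suc i)
    d-reflect i k eq = begin
      -1ℤ ^ suc k * c (suc k)     ≈⟨ *-cong (≡⇒≈ (s-neg i k eq)) (c-reflect i k eq) ⟩
      (- -1ℤ ^ suc i) * c (suc i) ≡⟨ neg-distribˡ-* (-1ℤ ^ suc i) (c (suc i)) ⟨
      - d (suc i)                 ∎

    antisymmetric⇒∑≈0 : ∀ f → (∀ i k → suc (i ℕ.+ k) ≡ N → f (suc k) ≈ - f (suc i)) → ∑ f N ≈ 0ℤ
    antisymmetric⇒∑≈0 f h = cancel 1 1<N (combine (-1ℤ · ≈-trans (≡⇒≈ (sym (∑-*ˡ -1ℤ f N)))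
        (∑-reverse f (λ j → -1ℤ * f j) N (λ i k eq → ≈-trans (h i k eq) (≡⇒≈ (sym (-1*i≡-i (f (suc i))))))))
      (lemma (∑ f N)))
      where
      lemma : ∀ x → + 2 * x - + 2 * 0ℤ ≡ -1ℤ * (-1ℤ * x - x)
      lemma = solve-∀

    ∑a≈0 : ∑ a N ≈ 0ℤ
    ∑a≈0 = antisymmetric⇒∑≈0 a inv-neg

    ∑d≈0 : ∑ d N ≈ 0ℤ
    ∑d≈0 = antisymmetric⇒∑≈0 d d-reflect

    inv-double : ∀ j → j ℕ.< n → + 2 * inv (suc j ℕ.+ suc j) ≈ inv (suc j)
    inv-double j j<n = cancel j j<N (combine
      (1ℤ · inv-inverse (j ℕ.+ suc j) (ℕ.+-mono-≤ j<n j<n) ⊞ -1ℤ · inv-inverse j j<N)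
      (lemma (+ suc j) (inv (suc j)) (inv (suc j ℕ.+ suc j))))
      where
      j<N : j ℕ.< N
      j<N = ℕ.<-≤-trans j<n (ℕ.m≤m+n n n)
      lemma : ∀ j i k → j * (+ 2 * k) - j * i ≡ 1ℤ * ((j + j) * k - 1ℤ) + -1ℤ * (j * i - 1ℤ)
      lemma = solve-∀

    -- Since 1/j = 2/(2j), H_n is twice the even part of the full range, hence `∑ a N + ∑ b N`, and
    -- the full harmonic sum vanishes.
    ∑a≈∑b : ∑ a n ≈ ∑ b N
    ∑a≈∑b = begin
      ∑ a n                                    ≈⟨ ∑-cong (λ j → + 2 * inv (j ℕ.+ j)) a n inv-double ⟨
      ∑ (λ j → + 2 * inv (j ℕ.+ j)) n          ≡⟨ ∑-*ˡ (+ 2) (λ j → inv (j ℕ.+ j)) n ⟩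
      + 2 * ∑ (λ j → inv (j ℕ.+ j)) n          ≡⟨ ∑-even a n ⟨
      ∑ a N + ∑ b N                            ≈⟨ +-cong ∑a≈0 ≈-refl ⟩
      0ℤ + ∑ b N                               ≡⟨ +-identityˡ (∑ b N) ⟩
      ∑ b N                                    ∎

    -- Sign and inverse both change sign under the reflection, so the two halves of the full sum
    -- agree.
    ∑b≈2∑b : ∑ b N ≈ ∑ b n + ∑ b n
    ∑b≈2∑b = ≈-sym (∑-reflect b b N b-reflect n n refl)

    -- Reflection gives `∑ c N ≈ ∑ c n + ∑ c n`, and the even terms give
    -- `+ 2 * (∑ c N + ∑ d N) ≈ ∑ c n`. As `∑ d N ≈ 0`, four times `∑ c n` equals itself, and
    -- `cancel 2` divides by 3.
    ∑c≈0 : ∑ c n ≈ 0ℤ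
    ∑c≈0 = cancel 2 2<N (combine
      (+ 2 · ∑-reflect c c N c-reflect n n refl ⊞ (- + 2) · ∑d≈0 ⊞ 1ℤ · double)
      (lemma (∑ c n) (∑ c N) (∑ d N)))
      where
      double : + 2 * (∑ c N + ∑ d N) ≈ ∑ c n
      double = begin
        + 2 * (∑ c N + ∑ d N)                     ≡⟨ cong (+ 2 *_) (∑-even c n) ⟩
        + 2 * (+ 2 * ∑ (λ j → c (j ℕ.+ j)) n)     ≡⟨ *-assoc (+ 2) (+ 2) (∑ (λ j → c (j ℕ.+ j)) n) ⟨
        + 4 * ∑ (λ j → c (j ℕ.+ j)) n             ≡⟨ ∑-*ˡ (+ 4) (λ j → c (j ℕ.+ j)) n ⟨
        ∑ (λ j → + 4 * c (j ℕ.+ j)) n             ≈⟨ ∑-cong (λ j → + 4 * c (j ℕ.+ j)) c n (λ j j<n → ≈-trans (≡⇒≈ (square (inv (suc j ℕ.+ suc j)))) (*-cong (inv-double j j<n) (inv-double j j<n))) ⟩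
        ∑ c n                                     ∎
        where
        square : ∀ x → + 4 * (x * x) ≡ + 2 * x * (+ 2 * x)
        square = solve-∀
      lemma : ∀ x y z → + 3 * x - + 3 * 0ℤ ≡ + 2 * (x + x - y) + (- + 2) * (z - 0ℤ) + 1ℤ * (+ 2 * (y + z) - x)
      lemma = solve-∀

    b*b≡c : ∀ j → b j * b j ≡ c j
    b*b≡c j = trans (lemma (-1ℤ ^ j) (inv j)) (trans (cong (_* c j) (s-square j)) (*-identityˡ (c j)))
      where
      lemma : ∀ s x → s * x * (s * x) ≡ s * s * (x * x)
      lemma = solve-∀

    -- The full alternating sum W

    partial-fractions : ∀ i k m → suc (i ℕ.+ k) ≡ m → m ℕ.< N →
      b (suc i) * b (suc k) ≈ b (suc m) * (a (suc i) + a (suc k))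
    partial-fractions i k m refl m<N = begin
      b (suc i) * b (suc k)
        ≡⟨ lemma₁ (-1ℤ ^ suc i) (-1ℤ ^ suc k) (inv (suc i)) (inv (suc k)) ⟩
      -1ℤ ^ suc i * -1ℤ ^ suc k * (inv (suc i) * inv (suc k))
        ≈⟨ *-cong (≡⇒≈ (trans (sym (^-distribˡ-+-* -1ℤ (suc i) (suc k))) (cong (-1ℤ ^_) suc+suc))) fractions ⟩
      -1ℤ ^ suc m * (inv (suc m) * (inv (suc i) + inv (suc k)))
        ≡⟨ *-assoc (-1ℤ ^ suc m) (inv (suc m)) _ ⟨
      b (suc m) * (a (suc i) + a (suc k)) ∎
      where
      suc+suc : suc i ℕ.+ suc k ≡ suc m
      suc+suc = cong suc (ℕ.+-suc i k)
      lemma₁ : ∀ s t x y → s * x * (t * y) ≡ s * t * (x * y)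
      lemma₁ = solve-∀
      lemma₂ : ∀ i k I K M → I * K - M * (I + K) ≡
        - (I * K) * ((i + k) * M - 1ℤ) + M * K * (i * I - 1ℤ) + M * I * (k * K - 1ℤ)
      lemma₂ = solve-∀
      fractions : inv (suc i) * inv (suc k) ≈ inv (suc m) * (inv (suc i) + inv (suc k))
      fractions = combine
        (- (inv (suc i) * inv (suc k)) · subst (λ z → + z * inv (suc m) ≈ 1ℤ) (sym suc+suc) (inv-inverse m m<N)
          ⊞ inv (suc m) * inv (suc k) · inv-inverse i (ℕ.<-trans (left< refl) m<N)
          ⊞ inv (suc m) * inv (suc i) · inv-inverse k (ℕ.<-trans (right< refl) m<N))
        (lemma₂ (+ suc i) (+ suc k) (inv (suc i)) (inv (suc k)) (inv (suc m)))

    triangle : ℕ → ℤ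
    triangle m = ∑ (λ i → b i * ∑ b (m ∸ i)) m

    w-d : ∀ m → w (suc m) - d (suc m) ≡ b (suc m) * ∑ a m
    w-d m = lemma (-1ℤ ^ suc m) (inv (suc m)) (∑ a m)
      where
      lemma : ∀ s x y → s * x * (y + x) - s * (x * x) ≡ s * x * y
      lemma = solve-∀

    -- Raising m by one adds the line i + j = m + 1, where partial fractions give 2 b(m+1) H_m. The
    -- bound keeps i + j below p, hence invertible.
    triangle≈ : ∀ m → m ℕ.≤ N → triangle m ≈ + 2 * ∑ (λ j → w j - d j) m
    triangle≈ zero    _   = ≈-refl
    triangle≈ (suc m) m<N = begin
      ∑ (λ i → b i * ∑ b (suc m ∸ i)) m + b (suc m) * ∑ b (m ∸ m)
        ≈⟨ +-cong (∑-cong (λ i → b i * ∑ b (suc m ∸ i)) (λ i → b i * ∑ b (m ∸ i) + b (suc m) * (a i + a (suc m ∸ i))) m row) (≡⇒≈ (trans (cong (λ z → b (suc m) * ∑ b z) (ℕ.n∸n≡0 m)) (*-zeroʳ (b (suc m))))) ⟩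
      ∑ (λ i → b i * ∑ b (m ∸ i) + b (suc m) * (a i + a (suc m ∸ i))) m + 0ℤ
        ≡⟨ +-identityʳ _ ⟩
      ∑ (λ i → b i * ∑ b (m ∸ i) + b (suc m) * (a i + a (suc m ∸ i))) m
        ≡⟨ ∑-+ (λ i → b i * ∑ b (m ∸ i)) (λ i → b (suc m) * (a i + a (suc m ∸ i))) m ⟩
      triangle m + ∑ (λ i → b (suc m) * (a i + a (suc m ∸ i))) m
        ≡⟨ cong (λ z → triangle m + z) (trans (∑-*ˡ (b (suc m)) (λ i → a i + a (suc m ∸ i)) m)
             (cong (b (suc m) *_) (∑-+ a (λ i → a (suc m ∸ i)) m))) ⟩
      triangle m + b (suc m) * (∑ a m + ∑ (λ i → a (suc m ∸ i)) m)
        ≈⟨ +-cong (triangle≈ m (ℕ.<⇒≤ m<N)) (*-congˡ (b (suc m)) (+-congˡ (∑ a m)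
             (∑-reverse a (λ i → a (suc m ∸ i)) m (λ { i k refl → ≡⇒≈ (cong (λ z → a z) (sym (suc-i∸i i k))) })))) ⟩
      + 2 * ∑ (λ j → w j - d j) m + b (suc m) * (∑ a m + ∑ a m)
        ≡⟨ lemma (∑ (λ j → w j - d j) m) (b (suc m)) (∑ a m) ⟩
      + 2 * (∑ (λ j → w j - d j) m + b (suc m) * ∑ a m)
        ≡⟨ cong (λ z → + 2 * (∑ (λ j → w j - d j) m + z)) (w-d m) ⟨
      + 2 * ∑ (λ j → w j - d j) (suc m) ∎
      where
      suc-i∸i : ∀ i k → suc (i ℕ.+ k) ∸ i ≡ suc k
      suc-i∸i i k = trans (cong (_∸ i) (sym (ℕ.+-suc i k))) (ℕ.m+n∸m≡n i (suc k))
      lemma : ∀ x y z → + 2 * x + y * (z + z) ≡ + 2 * (x + y * z)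
      lemma = solve-∀
      row : ∀ j → j ℕ.< m → b (suc j) * ∑ b (m ∸ j) ≈
            b (suc j) * ∑ b (m ∸ suc j) + b (suc m) * (a (suc j) + a (m ∸ j))
      row j j<m rewrite ℕ.+-∸-assoc 1 j<m = begin
        b (suc j) * (∑ b l + b (suc l))
          ≡⟨ *-distribˡ-+ (b (suc j)) (∑ b l) (b (suc l)) ⟩
        b (suc j) * ∑ b l + b (suc j) * b (suc l)
          ≈⟨ +-congˡ (b (suc j) * ∑ b l) (partial-fractions j l m (ℕ.m+[n∸m]≡n j<m) m<N) ⟩
        b (suc j) * ∑ b l + b (suc m) * (a (suc j) + a (suc l)) ∎
        where
        l = m ∸ suc j

    ∑[w-d] : ∀ m → ∑ (λ j → w j - d j) m ≡ ∑ w m - ∑ d m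
    ∑[w-d] zero    = refl
    ∑[w-d] (suc m) = trans (cong (_+ (w (suc m) - d (suc m))) (∑[w-d] m)) (lemma (∑ w m) (∑ d m) (w (suc m)) (d (suc m)))
      where
      lemma : ∀ x y z t → x - y + (z - t) ≡ x + z - (y + t)
      lemma = solve-∀

    -- triangle N sums (-1)ⁱ⁺ʲ/(ij) over i + j ≤ N; it is evaluated along the lines of constant
    -- i + j (triangle≈) and, by the symmetry of b, along those of constant i (triangle-N).
    ∑w≈β² : ∑ w N ≈ ∑ b n * ∑ b n
    -- The two evaluations read 2W and B² - Σ b(j) Σ_{i≤j} b(i), with B = `∑ b N`. By `∑-product`
    -- twice the last sum is B², as the squares sum to 0. So 4W ≡ B² ≡ 4 (`∑ b n`)², and 2 is
    -- cancelled twice.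
    ∑w≈β² = cancel 1 1<N (cancel 1 1<N (combine
      ((- + 2) · triangle≈ N ℕ.≤-refl ⊞ + 2 · triangle-N
        ⊞ -1ℤ · ≡⇒≈ (∑-product b b N) ⊞ -1ℤ · ≡⇒≈ (∑-≡ N b*b≡c)
        ⊞ 1ℤ · ∑-reflect c c N c-reflect n n refl ⊞ (- + 2) · ∑c≈0 ⊞ (∑ b N + (∑ b n + ∑ b n)) · ∑b≈2∑b
        ⊞ (- + 4) · ≡⇒≈ (∑[w-d] N) ⊞ + 4 · ∑d≈0)
      (lemma (∑ w N) (∑ b n) (triangle N) (∑ (λ j → w j - d j) N) (∑ b N) (∑ bB N)
        (∑ (λ j → b j * b j) N) (∑ c N) (∑ c n) (∑ d N))))
      where
      bB : ℕ → ℤ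
      bB j = b j * ∑ b j
      lemma : ∀ W B t y BN bB bb cN c d → + 2 * (+ 2 * W) - + 2 * (+ 2 * (B * B)) ≡
        (- + 2) * (t - + 2 * y) + + 2 * (t - (BN * BN - bB)) + -1ℤ * (bB + bB - (BN * BN + bb)) + -1ℤ * (bb - cN)
        + 1ℤ * (c + c - cN) + (- + 2) * (c - 0ℤ) + (BN + (B + B)) * (BN - (B + B))
        + (- + 4) * (y - (W - d)) + + 4 * (d - 0ℤ)
      lemma = solve-∀
      triangle-N : triangle N ≈ ∑ b N * ∑ b N - ∑ bB N
      triangle-N = begin
        triangle N
          ≈⟨ ∑-cong (λ i → b i * ∑ b (N ∸ i)) (λ i → ∑ b N * b i + -1ℤ * bB i) N row ⟩
        ∑ (λ i → ∑ b N * b i + -1ℤ * bB i) N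
          ≡⟨ ∑-+ (λ i → ∑ b N * b i) (λ i → -1ℤ * bB i) N ⟩
        ∑ (λ i → ∑ b N * b i) N + ∑ (λ i → -1ℤ * bB i) N
          ≡⟨ cong₂ _+_ (∑-*ˡ (∑ b N) b N) (∑-*ˡ -1ℤ bB N) ⟩
        ∑ b N * ∑ b N + -1ℤ * ∑ bB N
          ≡⟨ cong (λ z → ∑ b N * ∑ b N + z) (-1*i≡-i (∑ bB N)) ⟩
        ∑ b N * ∑ b N - ∑ bB N ∎
        where
        row : ∀ j → j ℕ.< N → b (suc j) * ∑ b (N ∸ suc j) ≈ ∑ b N * b (suc j) + -1ℤ * bB (suc j)
        row j j<N = combine
          (b (suc j) · ∑-reflect b b N b-reflect (suc j) (N ∸ suc j) (ℕ.m+[n∸m]≡n j<N))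
          (lemma₂ (b (suc j)) (∑ b (N ∸ suc j)) (∑ b N) (∑ b (suc j)))
          where
          lemma₂ : ∀ x y z t → x * y - (z * x + -1ℤ * (x * t)) ≡ x * (y + t - z)
          lemma₂ = solve-∀

    -- Half-range sums and the value of V

    ∑a-reflect : ∀ i k → i ℕ.+ k ≡ N → ∑ a k ≈ ∑ a i
    ∑a-reflect i k eq = combine (1ℤ · ∑-reflect a (λ j → -1ℤ * a j) N (λ i k eq → ≈-trans (inv-neg i k eq) (≡⇒≈ (sym (-1*i≡-i (a (suc i)))))) i k eq
        ⊞ 1ℤ · ∑a≈0 ⊞ -1ℤ · ≡⇒≈ (∑-*ˡ -1ℤ a i))
      (lemma (∑ a k) (∑ a i) (∑ (λ j → -1ℤ * a j) i) (∑ a N))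
      where
      lemma : ∀ x y z t → x - y ≡ 1ℤ * (x + z - t) + 1ℤ * (t - 0ℤ) + -1ℤ * (z - -1ℤ * y)
      lemma = solve-∀

    -- The harmonic number at p - j agrees with the one at j - 1, which lacks the term 1/j; hence
    -- the correction by `d`.
    w-reflect : ∀ i k → suc (i ℕ.+ k) ≡ N → w (suc k) ≈ w (suc i) - d (suc i)
    w-reflect i k eq = begin
      b (suc k) * ∑ a (suc k)  ≈⟨ *-cong (b-reflect i k eq) (∑a-reflect i (suc k) (trans (ℕ.+-suc i k) eq)) ⟩
      b (suc i) * ∑ a i        ≡⟨ w-d i ⟨
      w (suc i) - d (suc i)    ∎

    ∑w+∑w≈ : ∑ w n + ∑ w n ≈ ∑ d n + ∑ w N
    ∑w+∑w≈ = combine (1ℤ · ∑-reflect w (λ j → w j - d j) N w-reflect n n refl ⊞ -1ℤ · ≡⇒≈ (∑[w-d] n))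
      (lemma (∑ w n) (∑ d n) (∑ w N) (∑ (λ j → w j - d j) n))
      where
      lemma : ∀ w d W x → w + w - (d + W) ≡ 1ℤ * (w + x - W) + -1ℤ * (x - (w - d))
      lemma = solve-∀

    ∑odd : ℕ → ℤ
    ∑odd = ∑ (λ j → (1ℤ - -1ℤ ^ j) * inv j)

    V : ℕ → ℤ
    V = ∑ (λ m → inv m * (+ 2 + -1ℤ ^ m) * ∑odd m)

    ∑odd≡ : ∀ m → ∑odd m ≡ ∑ a m - ∑ b m
    ∑odd≡ zero    = refl
    ∑odd≡ (suc m) = trans (cong (_+ (1ℤ - -1ℤ ^ suc m) * inv (suc m)) (∑odd≡ m)) (lemma (∑ a m) (∑ b m) (-1ℤ ^ suc m) (inv (suc m)))
      where
      lemma : ∀ x y s z → x - y + (1ℤ - s) * z ≡ x + z - (y + s * z)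
      lemma = solve-∀

    V≡ : V n ≡ + 2 * ∑ (λ m → a m * ∑ a m) n + (- + 2) * ∑ (λ m → a m * ∑ b m) n + (∑ w n + -1ℤ * ∑ (λ m → b m * ∑ b m) n)
    V≡ = trans (∑-≡ n (λ m → trans (cong (inv m * (+ 2 + -1ℤ ^ m) *_) (∑odd≡ m)) (lemma (inv m) (-1ℤ ^ m) (∑ a m) (∑ b m))))
      (trans (∑-+ (λ m → + 2 * aA m + (- + 2) * aB m) (λ m → w m + -1ℤ * bB m) n)
        (cong₂ _+_
          (trans (∑-+ (λ m → + 2 * aA m) (λ m → (- + 2) * aB m) n) (cong₂ _+_ (∑-*ˡ (+ 2) aA n) (∑-*ˡ (- + 2) aB n)))
          (trans (∑-+ w (λ m → -1ℤ * bB m) n) (cong (λ z → ∑ w n + z) (∑-*ˡ -1ℤ bB n)))))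
      where
      aA aB bB : ℕ → ℤ
      aA m = a m * ∑ a m
      aB m = a m * ∑ b m
      bB m = b m * ∑ b m
      lemma : ∀ x s A B → x * (+ 2 + s) * (A - B) ≡ + 2 * (x * A) + (- + 2) * (x * B) + (s * x * A + -1ℤ * (s * x * B))
      lemma = solve-∀

    -- Write A, B for `∑ a n`, `∑ b n`. The product formula removes the nested sums and, with
    -- `∑ c n ≈ 0`, leaves 2V ≡ 2A² - B² - 4AB - 4D + 6X. Now insert A ≡ 2B and 2X ≡ D + B².
    V≈ : + 2 * V n ≈ + 2 * (∑ b n * ∑ b n) - ∑ d n
    V≈ = combine
      (+ 2 · ≡⇒≈ V≡ ⊞ + 2 · ≡⇒≈ (∑-product a a n) ⊞ -1ℤ · ≡⇒≈ (∑-product b b n) ⊞ -1ℤ · ≡⇒≈ (∑-≡ n b*b≡c)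
        ⊞ (- + 4) · ≡⇒≈ (∑-product a b n) ⊞ (- + 4) · ≡⇒≈ (∑-≡ {λ j → a j * b j} {d} n a*b≡d)
        ⊞ + 3 · ∑w+∑w≈ ⊞ + 3 · ∑w≈β² ⊞ + 2 * ∑ a n · ∑a≈2∑b ⊞ 1ℤ · ∑c≈0)
      (lemma (V n) (∑ (λ m → a m * ∑ a m) n) (∑ (λ m → a m * ∑ b m) n) (∑ w n) (∑ (λ m → b m * ∑ b m) n)
        (∑ a n) (∑ b n) (∑ c n) (∑ (λ j → b j * b j) n) (∑ d n) (∑ (λ j → a j * b j) n) (∑ w N))
      where
      a*b≡d : ∀ j → a j * b j ≡ d j
      a*b≡d j = lemma₁ (inv j) (-1ℤ ^ j)
        where
        lemma₁ : ∀ x s → x * (s * x) ≡ s * (x * x)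
        lemma₁ = solve-∀
      ∑a≈2∑b : ∑ a n ≈ ∑ b n + ∑ b n
      ∑a≈2∑b = ≈-trans ∑a≈∑b ∑b≈2∑b
      lemma : ∀ V aA aB w bB A B C bb D ab W → + 2 * V - (+ 2 * (B * B) - D) ≡
        + 2 * (V - (+ 2 * aA + (- + 2) * aB + (w + -1ℤ * bB)))
        + + 2 * (aA + aA - (A * A + C)) + -1ℤ * (bB + bB - (B * B + bb)) + -1ℤ * (bb - C)
        + (- + 4) * (aB + w - (A * B + ab)) + (- + 4) * (ab - D)
        + + 3 * (w + w - (D + W)) + + 3 * (W - B * B) + + 2 * A * (A - (B + B)) + 1ℤ * (C - 0ℤ)
      lemma = solve-∀

    -- The binomial transform of the squared harmonic numbers

    H′ H² : ℕ → ℤ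
    H′ = ∑ inv
    H² k = H′ k * H′ k

    -- The base comes from C(2k,k)/2ᵏ ≡ C(n,k) (-2)ᵏ. Since 1 + r = -1, raising m negates a
    -- transform up to a correction from the difference of the sequence.
    r : ℤ
    r = - + 2

    -- The left side of the conclusion is the increment of the transform of `f` from m to m + 1.
    -- Absorption expresses it through k f(k), in which the denominator k has disappeared.
    T-unabsorb : ∀ {f y} m → m ℕ.< N → T r (suc m) (λ k → + k * f k) ≈ y → r * T r m (f ∘ suc) ≈ inv (suc m) * y
    T-unabsorb {f} {y} m m<N h = combine
      (inv (suc m) · h ⊞ - (r * t) · inv-inverse m m<N ⊞ - inv (suc m) · ≡⇒≈ (T-absorb r m f))
      (lemma (r * t) (T r (suc m) (λ k → + k * f k)) y (+ suc m) (inv (suc m)))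
      where
      t = T r m (f ∘ suc)
      lemma : ∀ x t y m i → x - i * y ≡ i * (t - y) + - x * (m * i - 1ℤ) + - i * (t - m * x)
      lemma = solve-∀

    -- The sequence is 0 at k = 0 and 1 afterwards, so only the first term of (1 + r)ᵐ is missing.
    T-k*inv : ∀ m → m ℕ.≤ N → T r m (λ k → + k * inv k) ≈ -1ℤ ^ m - 1ℤ
    T-k*inv zero    _   = ≡⇒≈ refl
    T-k*inv (suc m) m<N = combine
      (1ℤ · T-k*inv m (ℕ.<⇒≤ m<N) ⊞ r · T-cong≈ r m (λ k k≤m → inv-inverse k (ℕ.≤-<-trans k≤m m<N)) ⊞ r · ≡⇒≈ (T-1 r m))
      (lemma r (T r m (λ k → + k * inv k)) (T r m (λ k → + suc k * inv (suc k))) (T r m (λ _ → 1ℤ)) (-1ℤ ^ m))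
      where
      lemma : ∀ r x y z s → x + (- + 2) * y - (-1ℤ * s - 1ℤ) ≡ 1ℤ * (x - (s - 1ℤ)) + (- + 2) * (y - z) + (- + 2) * (z - s)
      lemma = solve-∀

    T-inv-shift : ∀ m → m ℕ.< N → r * T r m (inv ∘ suc) ≈ inv (suc m) * (-1ℤ ^ suc m - 1ℤ)
    T-inv-shift m m<N = T-unabsorb {inv} m m<N (T-k*inv (suc m) m<N)

    T-inv : ∀ m → m ℕ.≤ N → T r m inv ≈ - ∑odd m
    T-inv zero    _   = ≡⇒≈ inv-zero
    T-inv (suc m) m<N = combine (1ℤ · T-inv m (ℕ.<⇒≤ m<N) ⊞ 1ℤ · T-inv-shift m m<N)
      (lemma (T r m inv) (r * T r m (inv ∘ suc)) (∑odd m) (-1ℤ ^ suc m) (inv (suc m)))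
      where
      lemma : ∀ x y o s i → x + y - - (o + (1ℤ - s) * i) ≡ 1ℤ * (x - - o) + 1ℤ * (y - i * (s - 1ℤ))
      lemma = solve-∀

    T-H : ∀ m → m ℕ.≤ N → T r m H′ ≈ -1ℤ ^ m * ∑odd m
    T-H zero    _   = ≈-refl
    T-H (suc m) m<N = combine
      (-1ℤ · T-H m (ℕ.<⇒≤ m<N) ⊞ 1ℤ · T-inv-shift m m<N ⊞ r · ≡⇒≈ (T-+ r m H′ (inv ∘ suc)) ⊞ inv (suc m) · ≡⇒≈ (s-square m))
      (lemma (T r m H′) (T r m (H′ ∘ suc)) (T r m (inv ∘ suc)) (∑odd m) (-1ℤ ^ m) (inv (suc m)))
      where
      lemma : ∀ x y z o s i → x + (- + 2) * y - -1ℤ * s * (o + (1ℤ - -1ℤ * s) * i) ≡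
        -1ℤ * (x - s * o) + 1ℤ * ((- + 2) * z - i * (-1ℤ * s - 1ℤ)) + (- + 2) * (y - (x + z)) + i * (s * s - 1ℤ)
      lemma = solve-∀

    -- The difference of consecutive squares is `f` at the upper index, and k f(k) is linear in H_k
    -- and 1/k, whose transforms are known.
    T-H² : ∀ m → m ℕ.≤ N → T r m H² ≈ -1ℤ ^ m * V m
    T-H² zero    _   = ≈-refl
    T-H² (suc m) m<N = combine
      (-1ℤ · T-H² m (ℕ.<⇒≤ m<N) ⊞ 1ℤ · T-unabsorb {f} m m<N k*f
        ⊞ r · ≡⇒≈ (trans (T-cong r m (λ k → square (H′ k) (inv (suc k)))) (T-+ r m H² (f ∘ suc)))
        ⊞ inv (suc m) * ∑odd (suc m) · ≡⇒≈ (sym (s-square (suc m))))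
      (lemma (T r m H²) (T r m (H² ∘ suc)) (T r m (f ∘ suc)) (V m) (-1ℤ ^ m) (inv (suc m)) (∑odd (suc m)))
      where
      f : ℕ → ℤ
      f k = (+ 2 * H′ k + -1ℤ * inv k) * inv k
      square : ∀ h i → (h + i) * (h + i) ≡ h * h + (+ 2 * (h + i) + -1ℤ * i) * i
      square = solve-∀
      pointwise : ∀ k → k ℕ.≤ suc m → + k * f k ≈ + 2 * H′ k + -1ℤ * inv k
      -- At k = 0 the identity rests on the convention `inv 0 ≡ 0ℤ`.
      pointwise zero    _         = ≡⇒≈ (cong (λ z → 0ℤ + -1ℤ * z) (sym inv-zero))
      pointwise (suc k) (s≤s k≤m) = combine ((+ 2 * H′ (suc k) + -1ℤ * inv (suc k)) · inv-inverse k (ℕ.≤-<-trans k≤m m<N))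
        (lemma₁ (+ suc k) (+ 2 * H′ (suc k) + -1ℤ * inv (suc k)) (inv (suc k)))
        where
        lemma₁ : ∀ k x i → k * (x * i) - x ≡ x * (k * i - 1ℤ)
        lemma₁ = solve-∀
      k*f : T r (suc m) (λ k → + k * f k) ≈ (+ 2 * -1ℤ ^ suc m + 1ℤ) * ∑odd (suc m)
      k*f = begin
        T r (suc m) (λ k → + k * f k)
          ≈⟨ T-cong≈ r (suc m) {λ k → + k * f k} {λ k → + 2 * H′ k + -1ℤ * inv k} pointwise ⟩
        T r (suc m) (λ k → + 2 * H′ k + -1ℤ * inv k)
          ≡⟨ T-+ r (suc m) (λ k → + 2 * H′ k) (λ k → -1ℤ * inv k) ⟩
        T r (suc m) (λ k → + 2 * H′ k) + T r (suc m) (λ k → -1ℤ * inv k)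
          ≡⟨ cong₂ _+_ (T-*ˡ r (suc m) (+ 2) H′) (T-*ˡ r (suc m) -1ℤ inv) ⟩
        + 2 * T r (suc m) H′ + -1ℤ * T r (suc m) inv
          ≈⟨ +-cong (*-congˡ (+ 2) (T-H (suc m) m<N)) (*-congˡ -1ℤ (T-inv (suc m) m<N)) ⟩
        + 2 * (-1ℤ ^ suc m * ∑odd (suc m)) + -1ℤ * - ∑odd (suc m)
          ≡⟨ lemma₂ (-1ℤ ^ suc m) (∑odd (suc m)) ⟩
        (+ 2 * -1ℤ ^ suc m + 1ℤ) * ∑odd (suc m) ∎
        where
        lemma₂ : ∀ s o → + 2 * (s * o) + -1ℤ * - o ≡ (+ 2 * s + 1ℤ) * o
        lemma₂ = solve-∀
      lemma : ∀ x y z v s i o → x + (- + 2) * y - -1ℤ * s * (v + i * (+ 2 + -1ℤ * s) * o) ≡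
        -1ℤ * (x - s * v) + 1ℤ * ((- + 2) * z - i * ((+ 2 * (-1ℤ * s) + 1ℤ) * o)) + (- + 2) * (y - (x + z))
        + i * o * (1ℤ - -1ℤ * s * (-1ℤ * s))
      lemma = solve-∀

    -- Compare consecutive ratios: 2(2k + 1)/(k + 1) · 1/2 on the left, -2(n - k)/(k + 1) on the
    -- right. They agree because 2n + 1 ≡ 0.
    central≈ : ∀ k → k ℕ.≤ n → binom (k ℕ.+ k) k * inv 2 ^ k ≈ binom n k * r ^ k
    central≈ zero    _   = ≈-refl
    central≈ (suc k) k<n = cancel k (ℕ.<-≤-trans k<n (ℕ.m≤m+n n n)) (combine
      (inv 2 * inv 2 ^ k · ≡⇒≈ (binom-central k) ⊞ + suc (k ℕ.+ k) * (binom (k ℕ.+ k) k * inv 2 ^ k) · inv-inverse 1 1<N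
        ⊞ + suc (k ℕ.+ k) · central≈ k (ℕ.<⇒≤ k<n) ⊞ binom n k * r ^ k · p≈0 ⊞ - (r * r ^ k) · ≡⇒≈ (binom-step n k))
      (lemma (+ k) (+ n) (binom (suc k ℕ.+ suc k) (suc k)) (binom (k ℕ.+ k) k) (inv 2) (inv 2 ^ k) (r ^ k) (binom n k) (binom n (suc k))))
      where
      lemma : ∀ k n B b i I R c C → (1ℤ + k) * (B * (i * I)) - (1ℤ + k) * (C * ((- + 2) * R)) ≡
        i * I * ((1ℤ + k) * B - + 2 * ((1ℤ + (k + k)) * b)) + (1ℤ + (k + k)) * (b * I) * (+ 2 * i - 1ℤ)
        + (1ℤ + (k + k)) * (b * I - c * R) + c * R * (1ℤ + (n + n) - 0ℤ) + - ((- + 2) * R) * ((1ℤ + k) * C - (n - k) * c)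
      lemma = solve-∀

    ∑central≈ : ∑ (λ k → binom (k ℕ.+ k) k * inv 2 ^ k * H² k) n ≈ -1ℤ ^ n * V n
    ∑central≈ = begin
      ∑ (λ k → binom (k ℕ.+ k) k * inv 2 ^ k * H² k) n
        ≈⟨ ∑-cong (λ k → binom (k ℕ.+ k) k * inv 2 ^ k * H² k) (λ k → binom n k * r ^ k * H² k) n
             (λ k k<n → *-cong (central≈ (suc k) k<n) ≈-refl) ⟩
      ∑ (λ k → binom n k * r ^ k * H² k) n
        ≡⟨ trans (T-binomial r n H²) (+-identityˡ _) ⟨
      T r n H²
        ≈⟨ T-H² n (ℕ.m≤m+n n n) ⟩
      -1ℤ ^ n * V n ∎

    -- Euler numbers modulo p

    Q : ℕ → ℤ
    Q = altPowerSum (suc N)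

    1≈Q0 : 1ℤ ≈ Q 0
    1≈Q0 = cancel 1 1<N (≡⇒≈ (trans (cong (λ s → 1ℤ - -1ℤ * s) (sym (s-double n))) (sym (alternating (suc N)))))
      where
      alternating : ∀ M → + 2 * altPowerSum M 0 ≡ 1ℤ - -1ℤ ^ M
      alternating zero    = refl
      alternating (suc M) = trans (lemma₁ (altPowerSum M 0) (-1ℤ ^ M))
        (trans (cong (_+ + 2 * -1ℤ ^ M) (alternating M)) (lemma₂ (-1ℤ ^ M)))
        where
        lemma₁ : ∀ x s → + 2 * (x + - (-1ℤ * s) * 1ℤ) ≡ + 2 * x + + 2 * s
        lemma₁ = solve-∀
        lemma₂ : ∀ s → 1ℤ - s + + 2 * s ≡ 1ℤ - -1ℤ * s
        lemma₂ = solve-∀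

    -- At M = p the right side of `altPowerSum-T` vanishes. Its left side consists of the terms `h`,
    -- the last being 2Q(r+1) and the earlier ones the doubled terms of the recursion for E(r+1).
    E-step : ∀ r → (∀ k → k ℕ.≤ r → E k ≈ Q k) → E (suc r) ≈ Q (suc r)
    E-step r hyp = cancel 1 1<N (combine
      (+ 2 · ≡⇒≈ (E-suc r) ⊞ -1ℤ · summand 0 z≤n ⊞ -1ℤ · ∑-summand ⊞ -1ℤ · T≈0 ⊞ 1ℤ · top)
      (lemma (E (suc r)) (Q (suc r)) (E-summand r 0 (E 0)) (∑ (λ k → E-summand r k (E k)) r) (g 0) (∑ h r) (h (suc r))))
      where
      s = -1ℤ ^ suc r
      g h : ℕ → ℤ
      g k = Q k + s * (-1ℤ ^ k * Q k)
      h k = binom (suc r) k * 1ℤ ^ k * g k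
      summand : ∀ k → k ℕ.≤ r → + 2 * E-summand r k (E k) ≈ h k
      summand k k≤r = begin
        + 2 * E-summand r k (E k)
          ≡⟨ 2E-summand r k k≤r (E k) ⟩
        (1ℤ + s * -1ℤ ^ k) * (binom (suc r) k * E k)
          ≈⟨ *-congˡ (1ℤ + s * -1ℤ ^ k) (*-congˡ (binom (suc r) k) (hyp k k≤r)) ⟩
        (1ℤ + s * -1ℤ ^ k) * (binom (suc r) k * Q k)
          ≡⟨ lemma₁ s (-1ℤ ^ k) (binom (suc r) k) (Q k) ⟩
        binom (suc r) k * 1ℤ * g k
          ≡⟨ cong (λ z → binom (suc r) k * z * g k) (^-zeroˡ k) ⟨
        h k ∎
        where
        lemma₁ : ∀ s t b q → (1ℤ + s * t) * (b * q) ≡ b * 1ℤ * (q + s * (t * q))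
        lemma₁ = solve-∀
      ∑-summand : + 2 * ∑ (λ k → E-summand r k (E k)) r ≈ ∑ h r
      ∑-summand = ≈-trans (≡⇒≈ (sym (∑-*ˡ (+ 2) (λ k → E-summand r k (E k)) r)))
        (∑-cong (λ k → + 2 * E-summand r k (E k)) h r (λ k k<r → summand (suc k) k<r))
      T≈0 : g 0 + (∑ h r + h (suc r)) ≈ 0ℤ
      T≈0 = begin
        g 0 + ∑ h (suc r)
          ≡⟨ T-binomial 1ℤ (suc r) g ⟨
        T 1ℤ (suc r) g
          ≡⟨ trans (T-+ 1ℤ (suc r) Q (λ k → s * (-1ℤ ^ k * Q k)))
               (cong (λ z → T 1ℤ (suc r) Q + z) (T-*ˡ 1ℤ (suc r) s (λ k → -1ℤ ^ k * Q k))) ⟩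
        T 1ℤ (suc r) Q + s * T 1ℤ (suc r) (λ k → -1ℤ ^ k * Q k)
          ≡⟨ altPowerSum-T (suc N) r ⟩
        - (-1ℤ ^ suc N) * ((+ suc N + + suc N) * (+ suc N + + suc N) ^ r)
          ≈⟨ *-congˡ (- (-1ℤ ^ suc N)) (*-cong (+-cong p≈0 p≈0) (≈-refl {(+ suc N + + suc N) ^ r})) ⟩
        - (-1ℤ ^ suc N) * (0ℤ * (+ suc N + + suc N) ^ r)
          ≡⟨ *-zeroʳ (- (-1ℤ ^ suc N)) ⟩
        0ℤ ∎
      top : h (suc r) ≈ + 2 * Q (suc r)
      top = ≡⇒≈ (trans (cong₂ (λ u v → u * v * g (suc r)) (binom-diag (suc r)) (^-zeroˡ (suc r)))
        (trans (lemma₂ (Q (suc r)) s) (trans (cong (λ z → Q (suc r) + z * Q (suc r)) (s-square (suc r))) (lemma₃ (Q (suc r))))))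
        where
        lemma₂ : ∀ q s → 1ℤ * 1ℤ * (q + s * (s * q)) ≡ q + s * s * q
        lemma₂ = solve-∀
        lemma₃ : ∀ q → q + 1ℤ * q ≡ + 2 * q
        lemma₃ = solve-∀
      lemma : ∀ e q G₀ ΣG g₀ Σh hᵣ → + 2 * e - + 2 * q ≡
        + 2 * (e - - (G₀ + ΣG)) + -1ℤ * (+ 2 * G₀ - 1ℤ * 1ℤ * g₀) + -1ℤ * (+ 2 * ΣG - Σh) + -1ℤ * (g₀ + (Σh + hᵣ) - 0ℤ) + 1ℤ * (hᵣ - + 2 * q)
      lemma = solve-∀

    E≈altPowerSum : ∀ r → E r ≈ Q r
    E≈altPowerSum = ℕ.<-rec _ λ where
      zero    _   → 1≈Q0
      (suc r) rec → E-step r (λ k k≤r → rec (s≤s k≤r))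

    ^-cong : ∀ {a b} k → a ≈ b → a ^ k ≈ b ^ k
    ^-cong zero    h = ≈-refl
    ^-cong (suc k) h = *-cong h (^-cong k h)

    odd-suc : ∀ k → odd (suc k) ≡ + suc (k ℕ.+ k)
    odd-suc k = lemma (+ k)
      where
      lemma : ∀ k → (1ℤ + k) + (1ℤ + k) - 1ℤ ≡ 1ℤ + (k + k)
      lemma = solve-∀

    -- The Euler number of index p - 3

    module _ (m : ℕ) (n≡ : n ≡ suc (suc m)) where

      K : ℕ
      K = suc m ℕ.+ suc m

      N≡ : N ≡ suc (suc K)
      N≡ = trans (cong₂ ℕ._+_ n≡ n≡) (cong suc (ℕ.+-suc (suc m) (suc m)))

      ^K≈c : ∀ k → k ℕ.< N → (+ suc k) ^ K ≈ c (suc k)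
      ^K≈c k k<N = combine
        (c (suc k) · ≈-trans (≡⇒≈ (cong (λ z → (+ suc k) ^ z) (sym N≡))) (fermat k k<N)
          ⊞ - ((+ suc k) ^ K * (+ suc k * inv (suc k) + 1ℤ)) · inv-inverse k k<N)
        (lemma (+ suc k) (inv (suc k)) ((+ suc k) ^ K))
        where
        lemma : ∀ u i x → x - i * i ≡ i * i * (u * (u * x) - 1ℤ) + - (x * (u * i + 1ℤ)) * (u * i - 1ℤ)
        lemma = solve-∀

      f g : ℕ → ℤ
      f j = - (-1ℤ ^ j) * odd j ^ K
      g i = -1ℤ ^ n * (-1ℤ ^ i * c (i ℕ.+ i))

      f-symmetric : ∀ i k → suc (i ℕ.+ k) ≡ suc N → f (suc k) ≈ f (suc i)
      f-symmetric i k eq = *-cong (≡⇒≈ (cong -_ sign)) (begin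
        odd (suc k) ^ K             ≈⟨ ^-cong K odd-neg ⟩
        (-1ℤ * odd (suc i)) ^ K     ≡⟨ *-^ -1ℤ (odd (suc i)) K ⟩
        -1ℤ ^ K * odd (suc i) ^ K   ≡⟨ cong (_* odd (suc i) ^ K) (s-double (suc m)) ⟩
        1ℤ * odd (suc i) ^ K        ≡⟨ *-identityˡ (odd (suc i) ^ K) ⟩
        odd (suc i) ^ K             ∎)
        where
        sign : -1ℤ ^ suc k ≡ -1ℤ ^ suc i
        sign = cong (-1ℤ *_) (trans (cong (-1ℤ ^_) (sym (ℕ.m+n∸m≡n i k)))
          (trans (s-∸ (ℕ.m≤m+n i k)) (trans (cong (λ z → -1ℤ ^ z * -1ℤ ^ i) (ℕ.suc-injective eq))
            (trans (cong (_* -1ℤ ^ i) (s-double n)) (*-identityˡ (-1ℤ ^ i))))))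
        odd-neg : odd (suc k) ≈ -1ℤ * odd (suc i)
        odd-neg = combine (+ 2 · ≈-trans (≡⇒≈ (cong +_ eq)) p≈0) (lemma (+ i) (+ k))
          where
          lemma : ∀ i k → ((1ℤ + k) + (1ℤ + k) - 1ℤ) - -1ℤ * ((1ℤ + i) + (1ℤ + i) - 1ℤ) ≡ + 2 * (1ℤ + (i + k) - 0ℤ)
          lemma = solve-∀

      f-middle : f (suc n) ≈ 0ℤ
      f-middle = begin
        -- At j = n + 1 the base 2j - 1 is p itself, and K is positive, so the power vanishes.
        - (-1ℤ ^ suc n) * odd (suc n) ^ K  ≈⟨ *-congˡ (- (-1ℤ ^ suc n)) (^-cong K (≈-trans (≡⇒≈ (odd-suc n)) p≈0)) ⟩
        - (-1ℤ ^ suc n) * 0ℤ               ≡⟨ *-zeroʳ (- (-1ℤ ^ suc n)) ⟩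
        0ℤ                                 ∎

      -- The odd number 2k + 1 is p - 2(i + 1), so its inverse square is that of an even number;
      -- halving it later produces D.
      f≈g : ∀ i k → suc (i ℕ.+ k) ≡ n → f (suc k) ≈ g (suc i)
      f≈g i k eq = begin
        - (-1ℤ * -1ℤ ^ k) * odd (suc k) ^ K
          ≈⟨ *-cong (≡⇒≈ sign) (≈-trans (≡⇒≈ (cong (_^ K) (odd-suc k))) (≈-trans (^K≈c (k ℕ.+ k) (right< {i ℕ.+ suc i} reflected)) (c-reflect (i ℕ.+ suc i) (k ℕ.+ k) reflected))) ⟩
        -1ℤ ^ n * -1ℤ ^ suc i * c (suc i ℕ.+ suc i)
          ≡⟨ *-assoc (-1ℤ ^ n) (-1ℤ ^ suc i) (c (suc i ℕ.+ suc i)) ⟩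
        g (suc i) ∎
        where
        reflected : suc (i ℕ.+ suc i ℕ.+ (k ℕ.+ k)) ≡ N
        reflected = trans (lemma i k) (cong₂ ℕ._+_ eq eq)
          where
          lemma : ∀ i k → suc (i ℕ.+ suc i ℕ.+ (k ℕ.+ k)) ≡ suc (i ℕ.+ k) ℕ.+ suc (i ℕ.+ k)
          lemma = ℕ.solve-∀
        sign : - (-1ℤ * -1ℤ ^ k) ≡ -1ℤ ^ n * -1ℤ ^ suc i
        sign = trans (lemma₁ (-1ℤ ^ k)) (trans (cong (-1ℤ ^_) (sym (trans (cong (_∸ suc i) (sym eq)) (ℕ.m+n∸m≡n i k))))
          (s-∸ {n} {suc i} (subst (suc i ℕ.≤_) eq (s≤s (ℕ.m≤m+n i k)))))
          where
          lemma₁ : ∀ x → - (-1ℤ * x) ≡ x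
          lemma₁ = solve-∀

      4∑g≈ : + 4 * ∑ g n ≈ -1ℤ ^ n * ∑ d n
      4∑g≈ = begin
        + 4 * ∑ g n                          ≡⟨ ∑-*ˡ (+ 4) g n ⟨
        ∑ (λ j → + 4 * g j) n                ≈⟨ ∑-cong (λ j → + 4 * g j) (λ j → -1ℤ ^ n * d j) n row ⟩
        ∑ (λ j → -1ℤ ^ n * d j) n            ≡⟨ ∑-*ˡ (-1ℤ ^ n) d n ⟩
        -1ℤ ^ n * ∑ d n                      ∎
        where
        row : ∀ j → j ℕ.< n → + 4 * g (suc j) ≈ -1ℤ ^ n * d (suc j)
        row j j<n = ≈-trans (≡⇒≈ (lemma (-1ℤ ^ n) (-1ℤ ^ suc j) (inv (suc j ℕ.+ suc j))))
          (*-congˡ (-1ℤ ^ n) (*-congˡ (-1ℤ ^ suc j) (*-cong (inv-double j j<n) (inv-double j j<n))))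
          where
          lemma : ∀ s t x → + 4 * (s * (t * (x * x))) ≡ s * (t * (+ 2 * x * (+ 2 * x)))
          lemma = solve-∀

      2E≈∑d : + 2 * E (N ∸ 2) ≈ -1ℤ ^ n * ∑ d n
      2E≈∑d = combine
        (+ 2 · ≈-trans (≡⇒≈ (cong (λ z → E (z ∸ 2)) N≡)) (E≈altPowerSum K)
          ⊞ (- + 2) · ∑-reflect f f (suc N) f-symmetric n (suc n) (ℕ.+-suc n n)
          ⊞ + 2 · f-middle ⊞ (- + 4) · ∑-reverse f g n f≈g ⊞ 1ℤ · 4∑g≈)
        (lemma (E (N ∸ 2)) (Q K) (∑ f n) (f (suc n)) (∑ g n) (-1ℤ ^ n * ∑ d n))
        where
        lemma : ∀ e q F f G D → + 2 * e - D ≡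
          + 2 * (e - q) + (- + 2) * (F + f + F - q) + + 2 * (f - 0ℤ) + (- + 4) * (G - F) + 1ℤ * (+ 4 * G - D)
        lemma = solve-∀

    -- The Fermat quotient of 2

    binom≈s : ∀ k → k ℕ.≤ N → binom N k ≈ -1ℤ ^ k
    binom≈s zero    _   = ≈-refl
    binom≈s (suc k) k<N = cancel k k<N (combine
      (1ℤ · ≡⇒≈ (binom-step N k) ⊞ binom N k · p≈0 ⊞ - + suc k · binom≈s k (ℕ.<⇒≤ k<N))
      (lemma (+ k) (+ N) (binom N k) (binom N (suc k)) (-1ℤ ^ k)))
      where
      lemma : ∀ k n x y s → (1ℤ + k) * y - (1ℤ + k) * (-1ℤ * s) ≡
        1ℤ * ((1ℤ + k) * y - (n - k) * x) + x * (1ℤ + n - 0ℤ) + - (1ℤ + k) * (x - s)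
      lemma = solve-∀

    -- C(p,k)/p = C(p-1,k-1)/k ≡ (-1)ᵏ⁻¹/k. The witness is the exact quotient by p, which no
    -- congruence modulo p would determine.
    ∑binom : ∀ m → m ℕ.≤ N → ∃ λ S → ∑ (binom (suc N)) m ≡ + suc N * S × S ≈ - ∑ b m
    ∑binom zero    _   = 0ℤ , sym (*-zeroʳ (+ suc N)) , ≈-refl
    ∑binom (suc m) m<N with ∑binom m (ℕ.<⇒≤ m<N) | p∣binom m m<N
    ... | S , eq , S≈ | divides x x-eq = S + x
      , trans (cong₂ _+_ eq x-eq) (lemma₁ (+ suc N) S x)
      , combine (1ℤ · S≈ ⊞ 1ℤ · x≈) (lemma₂ S x (∑ b m) (b (suc m)))
      where
      lemma₁ : ∀ p S x → p * S + x * p ≡ p * (S + x)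
      lemma₁ = solve-∀
      lemma₂ : ∀ S x B b → S + x - - (B + b) ≡ 1ℤ * (S - - B) + 1ℤ * (x - - b)
      lemma₂ = solve-∀
      lemma₃ : ∀ p m x → p * (m * x) ≡ m * (x * p)
      lemma₃ = solve-∀
      m*x≡ : + suc m * x ≡ binom N m
      m*x≡ = *-cancelˡ-≡ (+ suc N) _ _ (trans (lemma₃ (+ suc N) (+ suc m) x)
        (trans (cong (+ suc m *_) (sym x-eq)) (binom-absorb N m)))
      x≈ : x ≈ - b (suc m)
      x≈ = cancel m m<N (combine
        (1ℤ · ≡⇒≈ m*x≡ ⊞ 1ℤ · binom≈s m (ℕ.<⇒≤ m<N) ⊞ - (-1ℤ ^ m) · inv-inverse m m<N)
        (lemma₄ (+ suc m) x (binom N m) (-1ℤ ^ m) (inv (suc m))))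
        where
        lemma₄ : ∀ m x y s i → m * x - m * - (-1ℤ * s * i) ≡ 1ℤ * (m * x - y) + 1ℤ * (y - s) + - s * (m * i - 1ℤ)
        lemma₄ = solve-∀

    -- Summing C(p,k) over 0 < k < p gives 2ᵖ - 2 = 2(2ᵖ⁻¹ - 1), so 2q is the quotient S of
    -- `∑binom`.
    fermat-quotient≈ : ∀ q → (+ 2) ^ N - 1ℤ ≡ q * + suc N → q ≈ - ∑ b n
    fermat-quotient≈ q eq with ∑binom N ℕ.≤-refl
    ... | S , ∑≡ , S≈ = cancel 1 1<N (combine (1ℤ · ≡⇒≈ 2q≡S ⊞ 1ℤ · S≈ ⊞ -1ℤ · ∑b≈2∑b) (lemma₁ q S (∑ b N) (∑ b n)))
      where
      lemma₁ : ∀ q S B b → + 2 * q - + 2 * - b ≡ 1ℤ * (+ 2 * q - S) + 1ℤ * (S - - B) + -1ℤ * (B - (b + b))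
      lemma₁ = solve-∀
      lemma₂ : ∀ p q → p * (+ 2 * q) ≡ + 2 * (q * p)
      lemma₂ = solve-∀
      lemma₃ : ∀ x → + 2 * (x - 1ℤ) ≡ + 2 * x - + 2
      lemma₃ = solve-∀
      lemma₄ : ∀ x → 1ℤ + (x + 1ℤ) - + 2 ≡ x
      lemma₄ = solve-∀
      ∑-1 : ∀ m → ∑ (λ k → binom (suc N) k * 1ℤ ^ k) m ≡ ∑ (binom (suc N)) m
      ∑-1 m = ∑-≡ m (λ k → trans (cong (binom (suc N) k *_) (^-zeroˡ k)) (*-identityʳ _))
      2q≡S : + 2 * q ≡ S
      2q≡S = *-cancelˡ-≡ (+ suc N) _ _ (trans (lemma₂ (+ suc N) q) (trans (cong (+ 2 *_) (sym eq))
        (trans (lemma₃ ((+ 2) ^ N)) (trans (cong (_- + 2) (trans (binomial-theorem 1ℤ (suc N))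
          (cong (λ z → 1ℤ + z) (trans (∑-1 (suc N)) (cong₂ _+_ ∑≡ (binom-diag (suc N)))))))
          (lemma₄ (+ suc N * S))))))

  -- Reduction of rationals modulo p

  sumℚ-∷ʳ : ∀ xs x → sumℚ (xs ∷ʳ x) ≡ sumℚ xs ℚ.+ x
  sumℚ-∷ʳ []       x = trans (ℚ.+-identityʳ x) (sym (ℚ.+-identityˡ x))
  sumℚ-∷ʳ (y ∷ xs) x = trans (cong (y ℚ.+_) (sumℚ-∷ʳ xs x)) (sym (ℚ.+-assoc y (sumℚ xs) x))

  sumℚ-upTo : ∀ f n → sumℚ (map f (upTo (suc n))) ≡ sumℚ (map f (upTo n)) ℚ.+ f n
  sumℚ-upTo f n = trans (cong (sumℚ ∘ map f) (sym (upTo-∷ʳ n)))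
    (trans (cong sumℚ (map-++ f (upTo n) (n ∷ []))) (sumℚ-∷ʳ (map f (upTo n)) (f n)))

  module Reduction (p : ℕ) (p-prime : Prime p) where
    open Congruence p

    p∤1 : ¬ (p ℕ.∣ 1)
    p∤1 p∣1 with refl ← ℕ.∣1⇒≡1 p∣1 = contradiction p-prime (λ ())

    -- x ↦ a: the rational x is p-integral and its residue class modulo p is that of a.
    infix 4 _↦_
    data _↦_ (x : ℚ) (a : ℤ) : Set where
      reduces : ∀ n d → toℚᵘ x ≃ mkℚᵘ n d → ¬ (p ℕ.∣ suc d) → n ≈ a * + suc d → x ↦ a

    ↦-cong : ∀ {x a b} → a ≈ b → x ↦ a → x ↦ b
    ↦-cong {b = b} a≈b (reduces n d eq p∤d h) = reduces n d eq p∤d (≈-trans h (*-cong a≈b ≈-refl))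

    ↦-/ : ∀ i d a → ¬ (p ℕ.∣ suc d) → i ≈ a * + suc d → (i ℚ./ suc d) ↦ a
    ↦-/ i d a = reduces i d (ℚ.toℚᵘ-fromℚᵘ (mkℚᵘ i d))

    ↦-integer : ∀ i → (i ℚ./ 1) ↦ i
    ↦-integer i = ↦-/ i 0 i p∤1 (≡⇒≈ (sym (*-identityʳ i)))

    p∤* : ∀ c d → ¬ (p ℕ.∣ suc c) → ¬ (p ℕ.∣ suc d) → ¬ (p ℕ.∣ suc c ℕ.* suc d)
    p∤* c d p∤c p∤d h = Sum.[ p∤c , p∤d ] (euclidsLemma (suc c) (suc d) p-prime h)

    ↦-+ : ∀ {x y a b} → x ↦ a → y ↦ b → x ℚ.+ y ↦ a + b
    ↦-+ {x} {y} {a} {b} (reduces m c x≃ p∤c ha) (reduces n d y≃ p∤d hb) =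
      reduces _ _ (ℚᵘ.≃-trans (ℚ.toℚᵘ-homo-+ x y) (ℚᵘ.+-cong x≃ y≃)) (p∤* c d p∤c p∤d)
        (≈-trans (combine (+ suc d · ha ⊞ + suc c · hb) (lemma m n a b (+ suc c) (+ suc d)))
          (≡⇒≈ (cong ((a + b) *_) (sym (pos-* (suc c) (suc d))))))
      where
      lemma : ∀ m n a b c d → m * d + n * c - (a + b) * (c * d) ≡ d * (m - a * c) + c * (n - b * d)
      lemma = solve-∀

    ↦-* : ∀ {x y a b} → x ↦ a → y ↦ b → x ℚ.* y ↦ a * b
    ↦-* {x} {y} {a} {b} (reduces m c x≃ p∤c ha) (reduces n d y≃ p∤d hb) =
      reduces _ _ (ℚᵘ.≃-trans (ℚ.toℚᵘ-homo-* x y) (ℚᵘ.*-cong x≃ y≃)) (p∤* c d p∤c p∤d)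
        (≈-trans (*-cong ha hb) (≡⇒≈ (trans (lemma a b (+ suc c) (+ suc d)) (cong (a * b *_) (sym (pos-* (suc c) (suc d)))))))
      where
      lemma : ∀ a b c d → a * c * (b * d) ≡ a * b * (c * d)
      lemma = solve-∀

    ↦-neg : ∀ {x a} → x ↦ a → ℚ.- x ↦ - a
    ↦-neg {x} {a} (reduces n d x≃ p∤d h) =
      reduces (- n) d (ℚᵘ.≃-trans (ℚ.toℚᵘ-homo‿- x) (ℚᵘ.-‿cong x≃)) p∤d
        (combine (-1ℤ · h) (lemma n a (+ suc d)))
      where
      lemma : ∀ n a d → - n - - a * d ≡ -1ℤ * (n - a * d)
      lemma = solve-∀

    ↦-^ : ∀ {x a} → x ↦ a → ∀ k → x ^ℚ k ↦ a ^ k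
    ↦-^ h zero    = ↦-integer 1ℤ
    ↦-^ h (suc k) = ↦-* h (↦-^ h k)

    ↦-sum : ∀ {f g} n → (∀ i → i ℕ.< n → f i ↦ g (suc i)) → sumℚ (map f (upTo n)) ↦ ∑ g n
    ↦-sum zero    h = ↦-integer 0ℤ
    ↦-sum {f} {g} (suc n) h = subst (_↦ ∑ g (suc n)) (sym (sumℚ-upTo f n))
      (↦-+ (↦-sum n (λ i i<n → h i (ℕ.m<n⇒m<1+n i<n))) (h n (ℕ.n<1+n n)))

    -- If p divided the reduced denominator, cross-multiplication would make it divide the reduced
    -- numerator or the given denominator.
    p∤↧ : ∀ {x a} → x ↦ a → ¬ (p ℕ.∣ ↧ₙ x)
    p∤↧ {mkℚ m c coprime} (reduces n d (*≡* eq) p∤d _) p∣c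
      with euclid p-prime m (+ suc d) (subst (+ p ∣_) (sym eq) (∣n⇒∣m*n n (∣ᵤ⇒∣ p∣c)))
    ... | inj₁ p∣m = ⊥-elim-irr (p≢1 (coprime (∣⇒∣ᵤ p∣m , p∣c)))
      where
      p≢1 : ¬ (p ≡ 1)
      p≢1 refl = contradiction p-prime (λ ())
    ... | inj₂ p∣d = p∤d (∣⇒∣ᵤ p∣d)

    p∣↥ : ∀ {x a} → x ↦ a → a ≈ 0ℤ → p ℕ.∣ ∣ ↥ x ∣
    p∣↥ {mkℚ m c _} {a} (reduces n d (*≡* eq) p∤d h) a≈0
      with euclid p-prime m (+ suc d) (subst (+ p ∣_) (lemma m n a (+ suc c) (+ suc d) eq)
             (+ suc c · h ⊞ + suc c * + suc d · a≈0))
      where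
      lemma : ∀ m n a c d → m * d ≡ n * c → c * (n - a * d) + c * d * (a - 0ℤ) ≡ m * d
      lemma m n a c d eq = trans (lemma₁ n a c d) (sym eq)
        where
        lemma₁ : ∀ n a c d → c * (n - a * d) + c * d * (a - 0ℤ) ≡ n * c
        lemma₁ = solve-∀
    ... | inj₁ p∣m = ∣⇒∣ᵤ p∣m
    ... | inj₂ p∣d = contradiction (∣⇒∣ᵤ p∣d) p∤d

    ↦⇒modℚ : ∀ {x y a b} → x ↦ a → y ↦ b → a ≈ b → x ≡ y [modℚ p ]
    ↦⇒modℚ {a = a} {b} x↦ y↦ a≈b = p∤↧ x↦ , p∤↧ y↦ , p∣↥ (↦-+ x↦ (↦-neg y↦)) (combine (1ℤ · a≈b) (lemma a b))
      where
      lemma : ∀ a b → a + - b - 0ℤ ≡ 1ℤ * (a - b)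
      lemma = solve-∀

-- The rational statement

open Integers
open import Data.Integer.Divisibility.Signed using (module _∣_)
open import Data.Rational using (ℚ; ½; _*_; _-_; _/_)
open _∣_ using (quotient; equality)

odd-prime≥5 : ∀ n m → n ≡ suc (suc m) → Prime (suc (n ℕ.+ n)) →
    ∀ q → (+ 2) ℤ.^ (n ℕ.+ n) ℤ.- 1ℤ ≡ q ℤ.* + suc (n ℕ.+ n) →
    ∑[ 1 ≤ n ≤ (λ k → ((+ ((2 ℕ.* k) C k)) / 1) * (½ ^ℚ k) * (H k * H k)) ]
      ≡ sgn n * (q2 (suc (n ℕ.+ n)) * q2 (suc (n ℕ.+ n))) - (E (suc (n ℕ.+ n) ∸ 3) / 1) [modℚ suc (n ℕ.+ n) ]
odd-prime≥5 n m n≡ p-prime q q-eq =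
  ↦⇒modℚ sum↦ (↦-+ (↦-* (↦-^ (↦-neg (↦-integer 1ℤ)) n) (↦-* q2↦ q2↦)) (↦-neg (↦-integer (E (N ∸ 2))))) final
  where
  N = n ℕ.+ n
  N≡2+ : N ≡ suc (suc (suc m ℕ.+ suc m))
  N≡2+ = trans (cong₂ ℕ._+_ n≡ n≡) (cong suc (ℕ.+-suc (suc m) (suc m)))
  2<N : 2 ℕ.< N
  2<N rewrite N≡2+ = s≤s (s≤s (s≤s z≤n))
  open Congruence (suc N)
  open Fermat N p-prime
  open Reduction (suc N) p-prime
  -- The exponent is p - 2: Fermat's theorem makes this an inverse, and as the exponent is positive,
  -- 0 goes to 0.
  inv : ℕ → ℤ
  inv k = (+ k) ℤ.^ (N ∸ 1)
  inv-zero : inv 0 ≡ 0ℤ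
  inv-zero = cong (λ z → 0ℤ ℤ.^ (z ∸ 1)) N≡2+
  inv-inverse : ∀ k → k ℕ.< N → + suc k ℤ.* inv (suc k) ≈ 1ℤ
  inv-inverse k k<N = ≈-trans (≡⇒≈ (cong ((+ suc k) ℤ.^_) (ℕ.m+[n∸m]≡n {1} {N} (ℕ.<-trans (s≤s z≤n) 2<N)))) (fermat k k<N)
  open HalfRange n 2<N p-prime inv inv-zero inv-inverse hiding (N)
  inv↦ : ∀ i → i ℕ.< N → ((+ 1) / suc i) ↦ inv (suc i)
  inv↦ i i<N = ↦-/ (+ 1) i (inv (suc i)) (ℕ.>⇒∤ (s≤s i<N))
    (≈-trans (≈-sym (inv-inverse i i<N)) (≡⇒≈ (*-comm (+ suc i) (inv (suc i)))))
  H↦ : ∀ k → k ℕ.≤ N → H k ↦ H′ k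
  H↦ k k≤N = ↦-sum k (λ i i<k → inv↦ i (ℕ.<-≤-trans i<k k≤N))
  C↦ : ∀ k → ((+ ((2 ℕ.* k) C k)) / 1) ↦ binom (k ℕ.+ k) k
  C↦ k = ↦-cong (≡⇒≈ (trans (C≡binom (2 ℕ.* k) k) (cong (λ z → binom (k ℕ.+ z) k) (ℕ.+-identityʳ k)))) (↦-integer (+ ((2 ℕ.* k) C k)))
  sum↦ : ∑[ 1 ≤ n ≤ (λ k → ((+ ((2 ℕ.* k) C k)) / 1) * (½ ^ℚ k) * (H k * H k)) ] ↦
         ∑ (λ k → binom (k ℕ.+ k) k ℤ.* inv 2 ℤ.^ k ℤ.* H² k) n
  sum↦ = ↦-sum n (λ i i<n → ↦-* (↦-* (C↦ (suc i)) (↦-^ (inv↦ 1 1<N) (suc i))) (↦-* (H≤ i i<n) (H≤ i i<n)))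
    where
    H≤ : ∀ i → i ℕ.< n → H (suc i) ↦ H′ (suc i)
    H≤ i i<n = H↦ (suc i) (ℕ.≤-trans i<n (ℕ.m≤m+n n n))
  q2↦ : q2 (suc N) ↦ q
  -- As written, `q2` has denominator p, so it is first replaced by the equal fraction q/1.
  q2↦ = reduces q 0
    (ℚᵘ.≃-trans (ℚ.toℚᵘ-fromℚᵘ (mkℚᵘ (+ (2 ℕ.^ N ∸ 1)) N))
      (*≡* (trans (*-identityʳ (+ (2 ℕ.^ N ∸ 1))) (trans (2^n∸1 N) q-eq))))
    p∤1 (≡⇒≈ (sym (*-identityʳ q)))
  final : ∑ (λ k → binom (k ℕ.+ k) k ℤ.* inv 2 ℤ.^ k ℤ.* H² k) n ≈ -1ℤ ℤ.^ n ℤ.* (q ℤ.* q) ℤ.+ ℤ.- E (N ∸ 2)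
  final = ≈-trans ∑central≈ (cancel 1 1<N (combine
    (-1ℤ ℤ.^ n · V≈ ⊞ 1ℤ · 2E≈∑d m n≡ ⊞ + 2 ℤ.* (-1ℤ ℤ.^ n ℤ.* (∑ b n ℤ.- q)) · fermat-quotient≈ q q-eq)
    (lemma (-1ℤ ℤ.^ n) (V n) q (E (N ∸ 2)) (∑ b n) (∑ d n))))
    where
    lemma : ∀ s V q e β D → + 2 ℤ.* (s ℤ.* V) ℤ.- + 2 ℤ.* (s ℤ.* (q ℤ.* q) ℤ.+ ℤ.- e) ≡
      s ℤ.* (+ 2 ℤ.* V ℤ.- (+ 2 ℤ.* (β ℤ.* β) ℤ.- D)) ℤ.+ 1ℤ ℤ.* (+ 2 ℤ.* e ℤ.- s ℤ.* D)
      ℤ.+ + 2 ℤ.* (s ℤ.* (β ℤ.- q)) ℤ.* (q ℤ.- ℤ.- β)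
    lemma = solve-∀

n+n/2≡n : ∀ n → (n ℕ.+ n) ℕ./ 2 ≡ n
n+n/2≡n n = trans (cong (λ k → (n ℕ.+ k) ℕ./ 2) (sym (ℕ.+-identityʳ n))) (trans (cong (ℕ._/ 2) (ℕ.*-comm 2 n)) (ℕ.m*n/n≡m n 2))

halve : ∀ p → p % 2 ≡ 1 → p ≡ suc (p ℕ./ 2 ℕ.+ p ℕ./ 2)
halve p odd = trans (ℕ.m≡m%n+[m/n]*n p 2) (cong₂ ℕ._+_ odd
  (trans (ℕ.*-comm (p ℕ./ 2) 2) (cong (p ℕ./ 2 ℕ.+_) (ℕ.+-identityʳ (p ℕ./ 2)))))

odd-prime : ∀ n → Prime (suc (n ℕ.+ n)) →
    ∑[ 1 ≤ n ≤ (λ k → ((+ ((2 ℕ.* k) C k)) / 1) * (½ ^ℚ k) * (H k * H k)) ]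
      ≡ sgn n * (q2 (suc (n ℕ.+ n)) * q2 (suc (n ℕ.+ n))) - (E (suc (n ℕ.+ n) ∸ 3) / 1) [modℚ suc (n ℕ.+ n) ]
odd-prime zero          p-prime = contradiction p-prime (λ ())
-- For p = 3 the two sides evaluate to 1 and -2, which differ by 3.
odd-prime (suc zero)    _       = from-no (3 ℕ.∣? 1) , from-no (3 ℕ.∣? 1) , ℕ.∣-refl
odd-prime n@(suc (suc m)) p-prime = odd-prime≥5 n m refl p-prime (quotient p∣2^N-1) (equality p∣2^N-1)
  where
  p∣2^N-1 = Congruence.p∣a-b (Fermat.fermat (n ℕ.+ n) p-prime 1 (s≤s (s≤s z≤n)))

theorem1p2 : (p : ℕ) → Prime p → p % 2 ≡ 1 →
    ∑[ 1 ≤ (p ∸ 1) ℕ./ 2 ≤ (λ k → ((+ ((2 ℕ.* k) C k)) / 1) * (½ ^ℚ k) * (H k * H k)) ]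
    ≡ sgn ((p ∸ 1) ℕ./ 2) * (q2 p * q2 p) - (E (p ∸ 3) / 1) [modℚ p ]
-- Primality belongs to the transported family because it must follow p to its form 2(p/2) + 1; the
-- inner `subst` then replaces half of p - 1 by p/2.
theorem1p2 p p-prime p-odd = subst Statement (sym (halve p p-odd))
    (λ prime′ → subst (λ h → ∑[ 1 ≤ h ≤ summand ] ≡ sgn h * (q2 p′ * q2 p′) - (E (p′ ∸ 3) / 1) [modℚ p′ ])
      (sym (n+n/2≡n (p ℕ./ 2))) (odd-prime (p ℕ./ 2) prime′))
    p-prime
  where
  p′ = suc (p ℕ./ 2 ℕ.+ p ℕ./ 2)
  summand : ℕ → ℚ
  summand k = ((+ ((2 ℕ.* k) C k)) / 1) * (½ ^ℚ k) * (H k * H k)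
  Statement : ℕ → Set
  Statement p = Prime p → ∑[ 1 ≤ (p ∸ 1) ℕ./ 2 ≤ summand ] ≡ sgn ((p ∸ 1) ℕ./ 2) * (q2 p * q2 p) - (E (p ∸ 3) / 1) [modℚ p ]
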